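{- For every positive integer $q$, $$\#M\big(\mathcal{A}_q^{(B,\mathbf b)}\big)=\sum_{J\subseteq[m]}(-1)^{\#J}\tilde{d}_J(q)\,q^{n-r(J)}.$$ Moreover, there exists a quasi-polynomial $\chi^{\mathrm{quasi}}\big(\mathcal{A}^{(B,\mathbf b)},q\big)$ in $q$ with $\rho_C$ as a period such that $\#M\big(\mathcal{A}^{(B,\mathbf b)}_q\big)=\chi^{\mathrm{quasi}}\big(\mathcal{A}^{(B,\mathbf b)},q\big)$ for all integers $q>q_0$. More precisely, $\chi^{\mathrm{quasi}}\big(\mathcal{A}^{(B,\mathbf b)},q\big)$ has the form $$\chi^{\mathrm{quasi}}\big(\mathcal{A}^{(B,\mathbf b)},q\big)=\sum_{J\subseteq[m],\ \bar r(J)=r(J)}(-1)^{\#J}\tilde{d}_J(q)\,q^{n-r(J)}.$$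
   Context: Let $A$ be an $m\times n$ integer matrix with rows $\boldsymbol\alpha_1^T,\dots,\boldsymbol\alpha_m^T$, $B$ an $l\times n$ integer matrix ($l=0$ is allowed: no equations), $\mathbf a=(a_1,\dots,a_m)^T\in\mathbb{Z}^m$, $\mathbf b\in\mathbb{Z}^l$, and $[m]=\{1,\dots,m\}$. For a positive integer $q$, $\mathbb{Z}_q=\mathbb{Z}/q\mathbb{Z}$ and $[\cdot]_q$ is the entrywise reduction modulo $q$. Put $V_q(B,\mathbf b)=\{\mathbf x\in\mathbb{Z}_q^n : [B]_q\mathbf x=[\mathbf b]_q\}$ (possibly empty), $H_{i,q}^{(B,\mathbf b)}=\{\mathbf x\in V_q(B,\mathbf b): [\boldsymbol\alpha_i^T]_q\mathbf x=[a_i]_q\}$, and $M\big(\mathcal{A}_q^{(B,\mathbf b)}\big)=V_q(B,\mathbf b)\setminus\bigcup_{i=1}^m H_{i,q}^{(B,\mathbf b)}$. For $J\subseteq[m]$, let $A_J$ and $\mathbf a_J$ consist of the rows of $A$ and entries of $\mathbf a$ indexed by $J$; $C_J=\begin{bmatrix}B\\ A_J\end{bmatrix}$, $\mathbf c_J=\begin{bmatrix}\mathbf b\\ \mathbf a_J\end{bmatrix}$, $\bar C_J=[C_J\ \mathbf c_J]$; $r(J)=\operatorname{rank}C_J$, $\bar r(J)=\operatorname{rank}\bar C_J$ (ranks over $\mathbb{Q}$). The invariant factors of an integer matrix are the nonzero diagonal entries (taken positive, each dividing the next) of its Smith normal form; let $d_{J,1}\mid\cdots\mid d_{J,r(J)}$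 be those of $C_J$ and $\bar d_{J,1}\mid\cdots\mid\bar d_{J,\bar r(J)}$ those of $\bar C_J$. Put $\rho_C=\operatorname{lcm}\{d_{J,r(J)}: J\subseteq[m],\ \bar r(J)=r(J)\}$ and $q_0=\max\{\bar d_{J,\bar r(J)}: J\subseteq[m],\ \bar r(J)=r(J)+1\}$, with $q_0=0$ if no such $J$ exists; $d_{J,0}=1$ and the lcm of the empty set is $1$. Let $d_J(q)=\prod_{j=1}^{r(J)}\gcd(d_{J,j},q)$, and let $\tilde d_J(q)=d_J(q)$ if $\gcd(q,d_{J,j})=\gcd(q,\bar d_{J,j})$ for all $j=1,\dots,\bar r(J)$, and $\tilde d_J(q)=0$ otherwise, where $d_{J,\bar r(J)}:=0$ if $\bar r(J)=r(J)+1$ (and $\gcd(q,0)=q$). A function $f$ is a quasi-polynomial with period $\rho\in\mathbb{Z}_{>0}$ if there are polynomials $f_1,\dots,f_\rho\in\mathbb{Q}[t]$ such that $f(q)=f_j(q)$ for every positive integer $q\equiv j\pmod\rho$. -}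

module Defs where

open import Data.Bool.Base using (if_then_else_)
open import Data.Fin.Base using (Fin; zero; suc; toℕ)
open import Data.Fin.Properties using (any?; all?)
open import Data.Fin.Subset using (Subset; inside; outside; ∣_∣)
open import Data.Integer.Base as ℤ using (ℤ; +_; -[1+_]; 0ℤ; 1ℤ; -1ℤ)
open import Data.Integer.Divisibility.Signed as ℤ∣ using (divides)
import Data.Integer.DivMod as ℤ
import Data.Integer.Properties as ℤ
open import Data.List.Base as List
  using (List; []; _∷_; length; filter; foldr; upTo; cartesianProductWith; allFin)
open import Data.List.Relation.Unary.All as All using (All; []; _∷_)
open import Data.List.Relation.Unary.Linked using (Linked; []; [-]; _∷_)
open import Data.Nat.Base as ℕ using (ℕ; zero; suc; _≤_; _<_; z≤n; s≤s; _⊔_)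
open import Data.Nat.Divisibility using (_∣_)
open import Data.Nat.GCD using (gcd)
open import Data.Nat.Induction using (Acc; acc; <-wellFounded)
open import Data.Nat.LCM using (lcm)
open import Data.Nat.ListAction using (product)
import Data.Nat.Properties as ℕ
open import Data.Product.Base using (∃; _×_; _,_; proj₁; proj₂)
open import Data.Rational.Base as ℚ using (ℚ; 0ℚ; 1ℚ)
import Data.Rational.Properties as ℚ
open import Data.Vec.Base as Vec using (Vec)
open import Data.Vec.Functional as Vector using (Vector)
open import Function.Base using (_∘_; flip)
open import Relation.Binary.PropositionalEquality
  using (_≡_; _≢_; refl; sym; trans; cong; cong₂; subst; module ≡-Reasoning)
open import Relation.Nullary.Decidable.Core using (Dec; does; yes; no; ¬?; _×-dec_; decidable-stable)
open import Relation.Nullary.Negation.Core using (¬_)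

import Algebra.Bundles as Bundles
import Algebra.Properties.Semiring.Sum as SemiringSum
import Data.Integer.Solver as ℤSolver
import Data.Rational.Solver as ℚSolver

module ℤΣ = SemiringSum ℤ.+-*-semiring
module ℚΣ = SemiringSum (Bundles.CommutativeRing.semiring ℚ.+-*-commutativeRing)

Matrix : Set → ℕ → ℕ → Set
Matrix X m n = Fin m → Fin n → X

infix 4 _≐_
_≐_ : {X : Set} {m n : ℕ} → Matrix X m n → Matrix X m n → Set
M ≐ N = ∀ i j → M i j ≡ N i j

_ᵀ : {X : Set} {m n : ℕ} → Matrix X m n → Matrix X n m
(M ᵀ) i j = M j i

infixl 7 _·_
_·_ : {k m n : ℕ} → Matrix ℤ k m → Matrix ℤ m n → Matrix ℤ k n
(M · N) i j = ℤΣ.sum λ k → M i k ℤ.* N k j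

Id : {n : ℕ} → Matrix ℤ n n
Id zero    zero    = 1ℤ
Id zero    (suc _) = 0ℤ
Id (suc _) zero    = 0ℤ
Id (suc i) (suc j) = Id i j

record Unimodular {n : ℕ} (P : Matrix ℤ n n) : Set where
  field
    inverse  : Matrix ℤ n n
    inverseˡ : inverse · P ≐ Id
    inverseʳ : P · inverse ≐ Id

-- The m × n matrix with ds down the main diagonal and zeros elsewhere.
-- Entries of ds that do not fit are dropped; SmithForm excludes that case.
diag : {m n : ℕ} → List ℕ → Matrix ℤ m n
diag []       _       _       = 0ℤ
diag (d ∷ _)  zero    zero    = + d
diag (_ ∷ _)  zero    (suc _) = 0ℤ
diag (_ ∷ _)  (suc _) zero    = 0ℤ
diag (_ ∷ ds) (suc i) (suc j) = diag ds i j

record SmithForm {m n : ℕ} (C : Matrix ℤ m n) : Set where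
  field
    P            : Matrix ℤ m m
    Q            : Matrix ℤ n n
    P-unimodular : Unimodular P
    Q-unimodular : Unimodular Q
    factors      : List ℕ
    length≤rows  : length factors ≤ m
    length≤cols  : length factors ≤ n
    positive     : All (0 <_) factors
    chain        : Linked _∣_ factors
    diagonal     : P · C · Q ≐ diag factors

lincomb : {m n : ℕ} → Vector ℚ m → Matrix ℚ m n → Vector ℚ n
lincomb c V j = ℚΣ.sum λ i → c i ℚ.* V i j

Independent : {m n : ℕ} → Matrix ℚ m n → Set
Independent V = ∀ c → (∀ j → lincomb c V j ≡ 0ℚ) → ∀ i → c i ≡ 0ℚ

infix 4 _∈span_
_∈span_ : {m n : ℕ} → Vector ℚ n → Matrix ℚ m n → Set
v ∈span V = ∃ λ c → ∀ j → v j ≡ lincomb c V j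

record RowSpaceBasis {m n : ℕ} (C : Matrix ℚ m n) : Set where
  field
    size        : ℕ
    vectors     : Matrix ℚ size n
    independent : Independent vectors
    inRowSpace  : ∀ i → vectors i ∈span C
    spanning    : ∀ i → C i ∈span vectors

------------------------------------------------------------------------
-- Every integer matrix has a Smith normal form

module _ where
  open ≡-Reasoning
  open ℤSolver.+-*-Solver using (solve; _:=_; _:+_; _:*_; :-_)

  sum-zero : {n : ℕ} (f : Vector ℤ n) → (∀ i → f i ≡ 0ℤ) → ℤΣ.sum f ≡ 0ℤ
  sum-zero {n} f f≡0 = trans (ℤΣ.sum-cong-≗ f≡0) (ℤΣ.sum-replicate-zero n)

  Id-select : {n : ℕ} (i : Fin n) (v : Vector ℤ n) → ℤΣ.sum (λ k → Id i k ℤ.* v k) ≡ v i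
  Id-select zero v = begin
    1ℤ ℤ.* v zero ℤ.+ ℤΣ.sum (λ k → 0ℤ ℤ.* v (suc k))
      ≡⟨ cong₂ ℤ._+_ (ℤ.*-identityˡ (v zero)) (sum-zero _ λ k → ℤ.*-zeroˡ (v (suc k))) ⟩
    v zero ℤ.+ 0ℤ
      ≡⟨ ℤ.+-identityʳ (v zero) ⟩
    v zero ∎
  Id-select (suc i) v = begin
    0ℤ ℤ.* v zero ℤ.+ ℤΣ.sum (λ k → Id i k ℤ.* v (suc k))
      ≡⟨ cong₂ ℤ._+_ (ℤ.*-zeroˡ (v zero)) (Id-select i (v ∘ suc)) ⟩
    0ℤ ℤ.+ v (suc i)
      ≡⟨ ℤ.+-identityˡ (v (suc i)) ⟩
    v (suc i) ∎

  Id-sym : {n : ℕ} → Id {n} ᵀ ≐ Id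
  Id-sym zero    zero    = refl
  Id-sym zero    (suc j) = refl
  Id-sym (suc i) zero    = refl
  Id-sym (suc i) (suc j) = Id-sym i j

  ·-cong : {k m n : ℕ} {M M′ : Matrix ℤ k m} {N N′ : Matrix ℤ m n} →
           M ≐ M′ → N ≐ N′ → M · N ≐ M′ · N′
  ·-cong p q i j = ℤΣ.sum-cong-≗ λ k → cong₂ ℤ._*_ (p i k) (q k j)

  ·-congˡ : {k m n : ℕ} (M : Matrix ℤ k m) {N N′ : Matrix ℤ m n} → N ≐ N′ → M · N ≐ M · N′
  ·-congˡ M q = ·-cong {M = M} (λ _ _ → refl) q

  ·-congʳ : {k m n : ℕ} {M M′ : Matrix ℤ k m} (N : Matrix ℤ m n) → M ≐ M′ → M · N ≐ M′ · N
  ·-congʳ N p = ·-cong {N = N} p (λ _ _ → refl)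

  ·-identityˡ : {m n : ℕ} (M : Matrix ℤ m n) → Id · M ≐ M
  ·-identityˡ M i j = Id-select i (λ k → M k j)

  ·-transpose : {k m n : ℕ} (M : Matrix ℤ k m) (N : Matrix ℤ m n) → (M · N) ᵀ ≐ N ᵀ · M ᵀ
  ·-transpose M N i j = ℤΣ.sum-cong-≗ λ k → ℤ.*-comm (M j k) (N k i)

  ·-identityʳ : {m n : ℕ} (M : Matrix ℤ m n) → M · Id ≐ M
  ·-identityʳ M i j = begin
    (M · Id) i j        ≡⟨ ·-transpose M Id j i ⟩
    (Id ᵀ · M ᵀ) j i    ≡⟨ ·-congʳ (M ᵀ) Id-sym j i ⟩
    (Id · M ᵀ) j i      ≡⟨ ·-identityˡ (M ᵀ) j i ⟩
    M i j               ∎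

  ·-assoc : {h k m n : ℕ} (L : Matrix ℤ h k) (M : Matrix ℤ k m) (N : Matrix ℤ m n) →
            L · M · N ≐ L · (M · N)
  ·-assoc L M N i j = begin
    ℤΣ.sum (λ b → ℤΣ.sum (λ a → L i a ℤ.* M a b) ℤ.* N b j)
      ≡⟨ ℤΣ.sum-cong-≗ (λ b → ℤΣ.*-distribʳ-sum (N b j) (λ a → L i a ℤ.* M a b)) ⟩
    ℤΣ.sum (λ b → ℤΣ.sum (λ a → L i a ℤ.* M a b ℤ.* N b j))
      ≡⟨ ℤΣ.∑-comm (λ b a → L i a ℤ.* M a b ℤ.* N b j) ⟩
    ℤΣ.sum (λ a → ℤΣ.sum (λ b → L i a ℤ.* M a b ℤ.* N b j))
      ≡⟨ ℤΣ.sum-cong-≗ (λ a → ℤΣ.sum-cong-≗ (λ b → ℤ.*-assoc (L i a) (M a b) (N b j))) ⟩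
    ℤΣ.sum (λ a → ℤΣ.sum (λ b → L i a ℤ.* (M a b ℤ.* N b j)))
      ≡⟨ ℤΣ.sum-cong-≗ (λ a → ℤΣ.*-distribˡ-sum (L i a) (λ b → M a b ℤ.* N b j)) ⟨
    ℤΣ.sum (λ a → L i a ℤ.* ℤΣ.sum (λ b → M a b ℤ.* N b j)) ∎

  Id-unimodular : {n : ℕ} → Unimodular (Id {n})
  Id-unimodular = record
    { inverse = Id ; inverseˡ = ·-identityˡ Id ; inverseʳ = ·-identityˡ Id }

  ·-cancel-mid : {n : ℕ} (W X Y Z : Matrix ℤ n n) → X · Y ≐ Id → W · Z ≐ Id →
                 (W · X) · (Y · Z) ≐ Id
  ·-cancel-mid W X Y Z XY WZ i j = begin
    (W · X · (Y · Z)) i j     ≡⟨ ·-assoc W X (Y · Z) i j ⟩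
    (W · (X · (Y · Z))) i j   ≡⟨ ·-congˡ W (λ a b → ·-assoc X Y Z a b) i j ⟨
    (W · (X · Y · Z)) i j     ≡⟨ ·-congˡ W (·-congʳ Z XY) i j ⟩
    (W · (Id · Z)) i j        ≡⟨ ·-congˡ W (·-identityˡ Z) i j ⟩
    (W · Z) i j               ≡⟨ WZ i j ⟩
    Id i j                    ∎

  ·-unimodular : {n : ℕ} {P R : Matrix ℤ n n} → Unimodular P → Unimodular R → Unimodular (P · R)
  ·-unimodular {P = P} {R} p r = record
    { inverse  = R′ · P′
    ; inverseˡ = ·-cancel-mid R′ P′ P R (Unimodular.inverseˡ p) (Unimodular.inverseˡ r)
    ; inverseʳ = ·-cancel-mid P R R′ P′ (Unimodular.inverseʳ r) (Unimodular.inverseʳ p)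
    }
    where
    P′ = Unimodular.inverse p
    R′ = Unimodular.inverse r

  ᵀ-unimodular : {n : ℕ} {P : Matrix ℤ n n} → Unimodular P → Unimodular (P ᵀ)
  ᵀ-unimodular {P = P} p = record
    { inverse  = P′ ᵀ
    ; inverseˡ = λ i j → trans (sym (·-transpose P P′ i j)) (trans (inverseʳ j i) (Id-sym i j))
    ; inverseʳ = λ i j → trans (sym (·-transpose P′ P i j)) (trans (inverseˡ j i) (Id-sym i j))
    }
    where open Unimodular p renaming (inverse to P′)

  diag-transpose : {m n : ℕ} (ds : List ℕ) → diag {n} {m} ds ᵀ ≐ diag ds
  diag-transpose []       i       j       = refl
  diag-transpose (d ∷ ds) zero    zero    = refl
  diag-transpose (d ∷ ds) zero    (suc j) = refl
  diag-transpose (d ∷ ds) (suc i) zero    = refl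
  diag-transpose (d ∷ ds) (suc i) (suc j) = diag-transpose ds i j

  smith-transpose : {m n : ℕ} {C : Matrix ℤ m n} → SmithForm (C ᵀ) → SmithForm C
  smith-transpose {C = C} s = record
    { P            = Q ᵀ
    ; Q            = P ᵀ
    ; P-unimodular = ᵀ-unimodular Q-unimodular
    ; Q-unimodular = ᵀ-unimodular P-unimodular
    ; factors      = factors
    ; length≤rows  = length≤cols
    ; length≤cols  = length≤rows
    ; positive     = positive
    ; chain        = chain
    ; diagonal     = λ i j → begin
        (Q ᵀ · C · P ᵀ) i j     ≡⟨ ·-assoc (Q ᵀ) C (P ᵀ) i j ⟩
        (Q ᵀ · (C · P ᵀ)) i j   ≡⟨ ·-congˡ (Q ᵀ) (λ a b → ·-transpose P (C ᵀ) a b) i j ⟨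
        (Q ᵀ · (P · C ᵀ) ᵀ) i j ≡⟨ ·-transpose (P · C ᵀ) Q i j ⟨
        (P · C ᵀ · Q) j i       ≡⟨ diagonal j i ⟩
        diag factors j i        ≡⟨ diag-transpose factors i j ⟩
        diag factors i j        ∎
    }
    where open SmithForm s

  smith-row : {m n : ℕ} {C C′ : Matrix ℤ m n} (E : Matrix ℤ m m) → Unimodular E →
              E · C ≐ C′ → SmithForm C′ → SmithForm C
  smith-row {C = C} {C′} E e EC s = record
    { P            = P · E
    ; Q            = Q
    ; P-unimodular = ·-unimodular P-unimodular e
    ; Q-unimodular = Q-unimodular
    ; factors      = factors
    ; length≤rows  = length≤rows
    ; length≤cols  = length≤cols
    ; positive     = positive
    ; chain        = chain
    ; diagonal     = λ i j → begin
        (P · E · C · Q) i j   ≡⟨ ·-congʳ Q (·-assoc P E C) i j ⟩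
        (P · (E · C) · Q) i j ≡⟨ ·-congʳ Q (·-congˡ P EC) i j ⟩
        (P · C′ · Q) i j      ≡⟨ diagonal i j ⟩
        diag factors i j      ∎
    }
    where open SmithForm s

  smith-col : {m n : ℕ} {C C′ : Matrix ℤ m n} (E : Matrix ℤ n n) → Unimodular E →
              E · C ᵀ ≐ C′ ᵀ → SmithForm C′ → SmithForm C
  smith-col E e EC s = smith-transpose (smith-row E e EC (smith-transpose s))

  -- Row operation adding k i times row 0 to row suc i, for all i.
  shear : {m : ℕ} → Vector ℤ m → Matrix ℤ (suc m) (suc m)
  shear k zero    j       = Id zero j
  shear k (suc i) zero    = k i
  shear k (suc i) (suc j) = Id i j

  shear-head : {m n : ℕ} (k : Vector ℤ m) (C : Matrix ℤ (suc m) n) (j : Fin n) →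
               (shear k · C) zero j ≡ C zero j
  shear-head k C j = Id-select zero (λ i → C i j)

  shear-tail : {m n : ℕ} (k : Vector ℤ m) (C : Matrix ℤ (suc m) n) (i : Fin m) (j : Fin n) →
               (shear k · C) (suc i) j ≡ k i ℤ.* C zero j ℤ.+ C (suc i) j
  shear-tail k C i j = cong (ℤ._+_ (k i ℤ.* C zero j)) (Id-select i (λ a → C (suc a) j))

  shear-inverse : {m : ℕ} (k k′ : Vector ℤ m) → (∀ i → k i ℤ.+ k′ i ≡ 0ℤ) →
                  shear k · shear k′ ≐ Id
  shear-inverse k k′ eq zero    j       = shear-head k (shear k′) j
  shear-inverse k k′ eq (suc i) zero    = begin
    (shear k · shear k′) (suc i) zero ≡⟨ shear-tail k (shear k′) i zero ⟩
    k i ℤ.* 1ℤ ℤ.+ k′ i               ≡⟨ cong (ℤ._+ k′ i) (ℤ.*-identityʳ (k i)) ⟩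
    k i ℤ.+ k′ i                      ≡⟨ eq i ⟩
    0ℤ                                ∎
  shear-inverse k k′ eq (suc i) (suc j) = begin
    (shear k · shear k′) (suc i) (suc j) ≡⟨ shear-tail k (shear k′) i (suc j) ⟩
    k i ℤ.* 0ℤ ℤ.+ Id i j                ≡⟨ cong (ℤ._+ Id i j) (ℤ.*-zeroʳ (k i)) ⟩
    0ℤ ℤ.+ Id i j                        ≡⟨ ℤ.+-identityˡ (Id i j) ⟩
    Id i j                               ∎

  shear-unimodular : {m : ℕ} (k : Vector ℤ m) → Unimodular (shear k)
  shear-unimodular k = record
    { inverse  = shear (ℤ.-_ ∘ k)
    ; inverseˡ = shear-inverse (ℤ.-_ ∘ k) k (ℤ.+-inverseˡ ∘ k)
    ; inverseʳ = shear-inverse k (ℤ.-_ ∘ k) (ℤ.+-inverseʳ ∘ k)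
    }

  swap₀ : {m : ℕ} → Fin (suc m) → Fin (suc m) → Fin (suc m)
  swap₀ a zero = a
  swap₀ zero (suc i) = suc i
  swap₀ (suc zero) (suc zero) = zero
  swap₀ (suc zero) (suc (suc i)) = suc (suc i)
  swap₀ (suc (suc a)) (suc zero) = suc zero
  swap₀ (suc (suc a)) (suc (suc i)) with swap₀ (suc a) (suc i)
  ... | zero  = zero
  ... | suc k = suc (suc k)

  swap₀-hit : {m : ℕ} (a : Fin (suc m)) → swap₀ a a ≡ zero
  swap₀-hit zero = refl
  swap₀-hit (suc zero) = refl
  swap₀-hit (suc (suc a)) rewrite swap₀-hit (suc a) = refl

  swap₀-involutive : {m : ℕ} (a i : Fin (suc m)) → swap₀ a (swap₀ a i) ≡ i
  swap₀-involutive a zero = swap₀-hit a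
  swap₀-involutive zero (suc i) = refl
  swap₀-involutive (suc zero) (suc zero) = refl
  swap₀-involutive (suc zero) (suc (suc i)) = refl
  swap₀-involutive (suc (suc a)) (suc zero) = refl
  swap₀-involutive (suc (suc a)) (suc (suc i))
    with swap₀ (suc a) (suc i) | swap₀-involutive (suc a) (suc i)
  ... | zero  | eq = cong suc eq
  ... | suc k | eq rewrite eq = refl

  swap-matrix : {m : ℕ} → Fin (suc m) → Matrix ℤ (suc m) (suc m)
  swap-matrix a i = Id (swap₀ a i)

  swap-· : {m n : ℕ} (a : Fin (suc m)) (C : Matrix ℤ (suc m) n) →
           swap-matrix a · C ≐ C ∘ swap₀ a
  swap-· a C i j = Id-select (swap₀ a i) (λ k → C k j)

  swap-unimodular : {m : ℕ} (a : Fin (suc m)) → Unimodular (swap-matrix a)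
  swap-unimodular a = record
    { inverse = swap-matrix a ; inverseˡ = self ; inverseʳ = self }
    where
    self : swap-matrix a · swap-matrix a ≐ Id
    self i j = trans (swap-· a (swap-matrix a) i j) (cong (flip Id j) (swap₀-involutive a i))

  smith-swap-rows : {m n : ℕ} {C : Matrix ℤ (suc m) n} (a : Fin (suc m)) →
                    SmithForm (C ∘ swap₀ a) → SmithForm C
  smith-swap-rows {C = C} a = smith-row (swap-matrix a) (swap-unimodular a) (swap-· a C)

  -- The block sum of the 1 × 1 matrix s and X.
  block : {m n : ℕ} → ℤ → Matrix ℤ m n → Matrix ℤ (suc m) (suc n)
  block s X zero    zero    = s
  block s X zero    (suc _) = 0ℤ
  block s X (suc _) zero    = 0ℤ
  block s X (suc i) (suc j) = X i j

  block-· : {k m n : ℕ} (s t : ℤ) (X : Matrix ℤ k m) (Y : Matrix ℤ m n) →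
            block s X · block t Y ≐ block (s ℤ.* t) (X · Y)
  block-· {m = m} s t X Y zero zero =
    trans (cong (ℤ._+_ (s ℤ.* t)) (ℤΣ.sum-replicate-zero m)) (ℤ.+-identityʳ (s ℤ.* t))
  block-· s t X Y zero (suc j) =
    cong₂ ℤ._+_ (ℤ.*-zeroʳ s) (sum-zero _ λ k → ℤ.*-zeroˡ (Y k j))
  block-· s t X Y (suc i) zero =
    cong₂ ℤ._+_ (ℤ.*-zeroˡ t) (sum-zero _ λ k → ℤ.*-zeroʳ (X i k))
  block-· s t X Y (suc i) (suc j) =
    ℤ.+-identityˡ ((X · Y) i j)

  block-cong : {m n : ℕ} {s t : ℤ} {X Y : Matrix ℤ m n} → s ≡ t → X ≐ Y → block s X ≐ block t Y
  block-cong p q zero    zero    = p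
  block-cong p q zero    (suc _) = refl
  block-cong p q (suc _) zero    = refl
  block-cong p q (suc i) (suc j) = q i j

  block-Id : {n : ℕ} → block 1ℤ (Id {n}) ≐ Id
  block-Id zero    zero    = refl
  block-Id zero    (suc _) = refl
  block-Id (suc _) zero    = refl
  block-Id (suc i) (suc j) = refl

  block-diag : {m n : ℕ} (d : ℕ) (ds : List ℕ) → block {m} {n} (+ d) (diag ds) ≐ diag (d ∷ ds)
  block-diag d ds zero    zero    = refl
  block-diag d ds zero    (suc _) = refl
  block-diag d ds (suc _) zero    = refl
  block-diag d ds (suc i) (suc j) = refl

  block-unimodular : {n : ℕ} {s : ℤ} {X : Matrix ℤ n n} → s ℤ.* s ≡ 1ℤ →
                     Unimodular X → Unimodular (block s X)
  block-unimodular {s = s} {X} ss x = record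
    { inverse  = block s X′
    ; inverseˡ = λ i j → trans (block-· s s X′ X i j)
                               (trans (block-cong ss inverseˡ i j) (block-Id i j))
    ; inverseʳ = λ i j → trans (block-· s s X X′ i j)
                               (trans (block-cong ss inverseʳ i j) (block-Id i j))
    }
    where open Unimodular x renaming (inverse to X′)

  ∣-sum : {n : ℕ} {d : ℤ} (f : Vector ℤ n) → (∀ i → d ℤ∣.∣ f i) → d ℤ∣.∣ ℤΣ.sum f
  ∣-sum {zero}  f h = divides 0ℤ refl
  ∣-sum {suc n} f h = ℤ∣.∣m∣n⇒∣m+n (h zero) (∣-sum (f ∘ suc) (h ∘ suc))

  ∣-entries : {h k m n : ℕ} {d : ℤ} (L : Matrix ℤ h k) (M : Matrix ℤ k m) (N : Matrix ℤ m n) →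
              (∀ i j → d ℤ∣.∣ M i j) → ∀ i j → d ℤ∣.∣ (L · M · N) i j
  ∣-entries L M N dM i j =
    ∣-sum _ λ b → ℤ∣.∣m⇒∣m*n (N b j) (∣-sum _ λ a → ℤ∣.∣n⇒∣m*n (L i a) (dM a b))

  ∣-factors : {m n d : ℕ} (ds : List ℕ) → length ds ≤ m → length ds ≤ n →
              (∀ (i : Fin m) (j : Fin n) → + d ℤ∣.∣ diag ds i j) → All (d ∣_) ds
  ∣-factors []       _       _       h = []
  ∣-factors (e ∷ ds) (s≤s p) (s≤s q) h =
    ℤ∣.∣⇒∣ᵤ (h zero zero) ∷ ∣-factors ds p q (λ i j → h (suc i) (suc j))

  chain-∷ : {d : ℕ} (ds : List ℕ) → All (d ∣_) ds → Linked _∣_ ds → Linked _∣_ (d ∷ ds)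
  chain-∷ []       _       _ = [-]
  chain-∷ (_ ∷ _) (p ∷ _) l = p ∷ l

  unit : ℤ → ℤ
  unit (+ _)    = 1ℤ
  unit -[1+ _ ] = -1ℤ

  unit² : (p : ℤ) → unit p ℤ.* unit p ≡ 1ℤ
  unit² (+ _)    = refl
  unit² -[1+ _ ] = refl

  unit-* : (p : ℤ) → unit p ℤ.* p ℤ.* 1ℤ ≡ + ℤ.∣ p ∣
  unit-* p@(+ _)    = trans (ℤ.*-identityʳ (1ℤ ℤ.* p)) (ℤ.*-identityˡ p)
  unit-* p@(-[1+ _ ]) = trans (ℤ.*-identityʳ (-1ℤ ℤ.* p)) (ℤ.-1*i≡-i p)

  smith-block : {m n : ℕ} (p : ℤ) → p ≢ 0ℤ → (C : Matrix ℤ m n) →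
                (∀ i j → p ℤ∣.∣ C i j) → SmithForm C → SmithForm (block p C)
  smith-block p p≢0 C p∣C s = record
    { P            = block (unit p) P
    ; Q            = block 1ℤ Q
    ; P-unimodular = block-unimodular (unit² p) P-unimodular
    ; Q-unimodular = block-unimodular refl Q-unimodular
    ; factors      = ℤ.∣ p ∣ ∷ factors
    ; length≤rows  = s≤s length≤rows
    ; length≤cols  = s≤s length≤cols
    ; positive     = ℕ.n≢0⇒n>0 (p≢0 ∘ ℤ.∣i∣≡0⇒i≡0) ∷ positive
    ; chain        = chain-∷ factors
        (∣-factors factors length≤rows length≤cols λ i j →
          subst (+ ℤ.∣ p ∣ ℤ∣.∣_) (diagonal i j) (∣-entries P C Q (λ a b →
            ℤ∣.∣-trans ℤ∣.∣m∣∣m (p∣C a b)) i j))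
        chain
    ; diagonal     = λ i j → begin
        (block (unit p) P · block p C · block 1ℤ Q) i j
          ≡⟨ ·-congʳ (block 1ℤ Q) (block-· (unit p) p P C) i j ⟩
        (block (unit p ℤ.* p) (P · C) · block 1ℤ Q) i j
          ≡⟨ block-· (unit p ℤ.* p) 1ℤ (P · C) Q i j ⟩
        block (unit p ℤ.* p ℤ.* 1ℤ) (P · C · Q) i j
          ≡⟨ block-cong (unit-* p) diagonal i j ⟩
        block (+ ℤ.∣ p ∣) (diag factors) i j
          ≡⟨ block-diag ℤ.∣ p ∣ factors i j ⟩
        diag (ℤ.∣ p ∣ ∷ factors) i j ∎
    }
    where open SmithForm s

  Smaller : (m n : ℕ) → ℤ → Set
  Smaller m n p = (C : Matrix ℤ (suc m) (suc n)) → C zero zero ≢ 0ℤ →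
                  ℤ.∣ C zero zero ∣ < ℤ.∣ p ∣ → SmithForm C

  rem : (a p : ℤ) .{{_ : ℤ.NonZero p}} → (ℤ.- (a ℤ./ p)) ℤ.* p ℤ.+ a ≡ + (a ℤ.% p)
  rem a p = begin
    (ℤ.- t) ℤ.* p ℤ.+ a
      ≡⟨ cong (ℤ._+_ ((ℤ.- t) ℤ.* p)) (ℤ.a≡a%n+[a/n]*n a p) ⟩
    (ℤ.- t) ℤ.* p ℤ.+ (+ (a ℤ.% p) ℤ.+ t ℤ.* p)
      ≡⟨ solve 3 (λ x y z → (:- x) :* y :+ (z :+ x :* y) := z) refl t p (+ (a ℤ.% p)) ⟩
    + (a ℤ.% p) ∎
    where t = a ℤ./ p

  descend-row : {m n : ℕ} (C : Matrix ℤ (suc m) (suc n)) .{{_ : ℤ.NonZero (C zero zero)}} →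
                (a : Fin m) → C (suc a) zero ℤ.% C zero zero ≢ 0 →
                Smaller m n (C zero zero) → SmithForm C
  descend-row C a r≢0 smaller =
    smith-row (shear k) (shear-unimodular k) (λ _ _ → refl)
      (smith-swap-rows (suc a)
        (smaller _
          (λ eq → r≢0 (ℤ.+-injective (trans (sym pivot) eq)))
          (subst (λ z → ℤ.∣ z ∣ < ℤ.∣ p ∣) (sym pivot) (ℤ.n%d<d (C (suc a) zero) p))))
    where
    p = C zero zero
    k = λ i → ℤ.- (C (suc i) zero ℤ./ p)
    pivot : (shear k · C) (suc a) zero ≡ + (C (suc a) zero ℤ.% p)
    pivot = trans (shear-tail k C a zero) (rem (C (suc a) zero) p)

  descend-col : {m n : ℕ} (C : Matrix ℤ (suc m) (suc n)) .{{_ : ℤ.NonZero (C zero zero)}} →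
                (b : Fin n) → C zero (suc b) ℤ.% C zero zero ≢ 0 →
                Smaller m n (C zero zero) → SmithForm C
  descend-col C b r≢0 smaller =
    smith-transpose (descend-row (C ᵀ) b r≢0 λ C′ ≢0 lt → smith-transpose (smaller (C′ ᵀ) ≢0 lt))

  smith-pivot : {m n : ℕ} → ((C : Matrix ℤ m n) → SmithForm C) →
                (C : Matrix ℤ (suc m) (suc n)) → C zero zero ≢ 0ℤ →
                Acc _<_ ℤ.∣ C zero zero ∣ → SmithForm C
  smith-pivot {m} {n} recurse C p≢0 (acc rs) = go
    where
    p = C zero zero
    instance
      p-nonZero : ℤ.NonZero p
      p-nonZero = ℤ.≢-nonZero p≢0

    smaller : Smaller m n p
    smaller C′ ≢0 lt = smith-pivot recurse C′ ≢0 (rs lt)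

    k : Vector ℤ m
    k i = ℤ.- (C (suc i) zero ℤ./ p)

    l : Vector ℤ n
    l j = ℤ.- (C zero (suc j) ℤ./ p)

    D : Matrix ℤ m n
    D i j = k i ℤ.* C zero (suc j) ℤ.+ C (suc i) (suc j)

    C₁ : Matrix ℤ (suc m) (suc n)
    C₁ = shear k · C

    via-block : (∀ i → C (suc i) zero ℤ.% p ≡ 0) → (∀ j → C zero (suc j) ℤ.% p ≡ 0) →
                SmithForm (block p D) → SmithForm C
    via-block col row s =
      smith-row (shear k) (shear-unimodular k) (λ _ _ → refl)
        (smith-col (shear l) (shear-unimodular l) (λ j i → clear i j) s)
      where
      col₁ : ∀ i → C₁ (suc i) zero ≡ 0ℤ
      col₁ i = trans (shear-tail k C i zero) (trans (rem (C (suc i) zero) p) (cong +_ (col i)))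
      clear : ∀ i j → (shear l · C₁ ᵀ) j i ≡ block p D i j
      clear zero    zero    = trans (shear-head l (C₁ ᵀ) zero) (shear-head k C zero)
      clear (suc i) zero    = trans (shear-head l (C₁ ᵀ) (suc i)) (col₁ i)
      clear zero    (suc j) = begin
        (shear l · C₁ ᵀ) (suc j) zero            ≡⟨ shear-tail l (C₁ ᵀ) j zero ⟩
        l j ℤ.* C₁ zero zero ℤ.+ C₁ zero (suc j) ≡⟨ cong₂ (λ x y → l j ℤ.* x ℤ.+ y)
                                                      (shear-head k C zero) (shear-head k C (suc j)) ⟩
        l j ℤ.* p ℤ.+ C zero (suc j)             ≡⟨ rem (C zero (suc j)) p ⟩
        + (C zero (suc j) ℤ.% p)                 ≡⟨ cong +_ (row j) ⟩
        0ℤ                                       ∎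
      clear (suc i) (suc j) = begin
        (shear l · C₁ ᵀ) (suc j) (suc i)                   ≡⟨ shear-tail l (C₁ ᵀ) j (suc i) ⟩
        l j ℤ.* C₁ (suc i) zero ℤ.+ C₁ (suc i) (suc j)     ≡⟨ cong₂ (λ x y → l j ℤ.* x ℤ.+ y)
                                                                (col₁ i) (shear-tail k C i (suc j)) ⟩
        l j ℤ.* 0ℤ ℤ.+ D i j                               ≡⟨ cong (ℤ._+ D i j) (ℤ.*-zeroʳ (l j)) ⟩
        0ℤ ℤ.+ D i j                                       ≡⟨ ℤ.+-identityˡ (D i j) ⟩
        D i j                                              ∎

    -- block p D with row suc a added to row 0.
    module _ (a : Fin m) where
      mixed : Matrix ℤ (suc m) (suc n)
      mixed zero    zero    = p
      mixed zero    (suc j) = D a j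
      mixed (suc i) j       = block p D (suc i) j

      mix : (shear (Id a)) ᵀ · block p D ≐ mixed
      mix zero zero = trans
        (cong₂ ℤ._+_ (ℤ.*-identityˡ p) (sum-zero _ λ i → ℤ.*-zeroʳ (Id a i)))
        (ℤ.+-identityʳ p)
      mix zero (suc j) = trans
        (cong (ℤ._+_ (1ℤ ℤ.* 0ℤ)) (Id-select a (λ i → D i j)))
        (ℤ.+-identityˡ (D a j))
      mix (suc i) j = trans
        (cong₂ ℤ._+_ (ℤ.*-zeroˡ (block p D zero j))
          (trans (ℤΣ.sum-cong-≗ (λ b → cong (ℤ._* block p D (suc b) j) (Id-sym i b)))
                 (Id-select i (λ b → block p D (suc b) j))))
        (ℤ.+-identityˡ (block p D (suc i) j))

    ∣-from-rem : (x : ℤ) → x ℤ.% p ≡ 0 → p ℤ∣.∣ x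
    ∣-from-rem x eq = divides (x ℤ./ p) (begin
      x                                   ≡⟨ ℤ.a≡a%n+[a/n]*n x p ⟩
      + (x ℤ.% p) ℤ.+ (x ℤ./ p) ℤ.* p     ≡⟨ cong (λ r → + r ℤ.+ (x ℤ./ p) ℤ.* p) eq ⟩
      0ℤ ℤ.+ (x ℤ./ p) ℤ.* p              ≡⟨ ℤ.+-identityˡ _ ⟩
      (x ℤ./ p) ℤ.* p                     ∎)

    bad? : (x : ℤ) → Dec (x ℤ.% p ≢ 0)
    bad? x = ¬? (x ℤ.% p ℕ.≟ 0)

    all-good : {k : ℕ} (f : Vector ℤ k) → ¬ (∃ λ i → f i ℤ.% p ≢ 0) → ∀ i → f i ℤ.% p ≡ 0
    all-good f none i = decidable-stable (f i ℤ.% p ℕ.≟ 0) λ h → none (i , h)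

    go : SmithForm C
    go with any? (λ i → bad? (C (suc i) zero))
    ... | yes (i , r≢0) = descend-row C i r≢0 smaller
    ... | no col with any? (λ j → bad? (C zero (suc j)))
    ...   | yes (j , r≢0) = descend-col C j r≢0 smaller
    ...   | no row with any? (λ i → any? (λ j → bad? (D i j)))
    ...     | yes (i , j , r≢0) =
      via-block (all-good (λ i → C (suc i) zero) col) (all-good (λ j → C zero (suc j)) row)
        (smith-row _ (ᵀ-unimodular (shear-unimodular (Id i))) (mix i)
          (descend-col (mixed i) j r≢0 smaller))
    ...     | no rest =
      via-block (all-good (λ i → C (suc i) zero) col) (all-good (λ j → C zero (suc j)) row)
        (smith-block p p≢0 D
          (λ i j → ∣-from-rem (D i j) (all-good (D i) (λ (j , h) → rest (i , j , h)) j))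
          (recurse D))

  smith-zero : {m n : ℕ} {C : Matrix ℤ m n} → (∀ i j → C i j ≡ 0ℤ) → SmithForm C
  smith-zero {C = C} C≡0 = record
    { P            = Id
    ; Q            = Id
    ; P-unimodular = Id-unimodular
    ; Q-unimodular = Id-unimodular
    ; factors      = []
    ; length≤rows  = z≤n
    ; length≤cols  = z≤n
    ; positive     = []
    ; chain        = []
    ; diagonal     = λ i j → trans (·-identityʳ (Id · C) i j) (trans (·-identityˡ C i j) (C≡0 i j))
    }

  smith : {m n : ℕ} (C : Matrix ℤ m n) → SmithForm C
  smith {zero}          C = smith-zero λ ()
  smith {suc m} {zero}  C = smith-zero λ _ ()
  smith {suc m} {suc n} C with any? (λ i → any? (λ j → ¬? (C i j ℤ.≟ 0ℤ)))
  ... | no all-zero = smith-zero λ i j →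
    decidable-stable (C i j ℤ.≟ 0ℤ) λ ≢0 → all-zero (i , j , ≢0)
  ... | yes (i , j , ≢0) =
    smith-swap-rows i (smith-transpose (smith-swap-rows j (smith-transpose
      (smith-pivot smith (λ a b → C (swap₀ i a) (swap₀ j b)) ≢0 (<-wellFounded _)))))

------------------------------------------------------------------------
-- Every rational matrix has a basis of its row space (Gaussian elimination)

module _ where
  open ≡-Reasoning
  open ℚSolver.+-*-Solver using (solve; _:=_; _:+_; _:*_; :-_)

  ℚsum-zero : {n : ℕ} (f : Vector ℚ n) → (∀ i → f i ≡ 0ℚ) → ℚΣ.sum f ≡ 0ℚ
  ℚsum-zero {n} f f≡0 = trans (ℚΣ.sum-cong-≗ f≡0) (ℚΣ.sum-replicate-zero n)

  lincomb-zeros : {m : ℕ} (c v : Vector ℚ m) → (∀ i → v i ≡ 0ℚ) →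
                  ℚΣ.sum (λ i → c i ℚ.* v i) ≡ 0ℚ
  lincomb-zeros c v v≡0 =
    ℚsum-zero _ λ i → trans (cong (c i ℚ.*_) (v≡0 i)) (ℚ.*-zeroʳ (c i))

  unitVector : {m : ℕ} → Fin m → Vector ℚ m
  unitVector zero    zero    = 1ℚ
  unitVector zero    (suc _) = 0ℚ
  unitVector (suc _) zero    = 0ℚ
  unitVector (suc i) (suc j) = unitVector i j

  unit-select : {m : ℕ} (i : Fin m) (v : Vector ℚ m) →
                ℚΣ.sum (λ k → unitVector i k ℚ.* v k) ≡ v i
  unit-select zero v = trans
    (cong₂ ℚ._+_ (ℚ.*-identityˡ (v zero)) (ℚsum-zero _ λ k → ℚ.*-zeroˡ (v (suc k))))
    (ℚ.+-identityʳ (v zero))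
  unit-select (suc i) v = trans
    (cong₂ ℚ._+_ (ℚ.*-zeroˡ (v zero)) (unit-select i (v ∘ suc)))
    (ℚ.+-identityˡ (v (suc i)))

  pad : {m n : ℕ} → Matrix ℚ m n → Matrix ℚ m (suc n)
  pad V i zero    = 0ℚ
  pad V i (suc j) = V i j

  basis-zero-column : {m n : ℕ} (V : Matrix ℚ m (suc n)) → (∀ i → V i zero ≡ 0ℚ) →
                      RowSpaceBasis (λ i j → V i (suc j)) → RowSpaceBasis V
  basis-zero-column {n = n} V V≡0 B = record
    { size        = size
    ; vectors     = pad vectors
    ; independent = λ c h → independent c (h ∘ suc)
    ; inRowSpace  = λ i → proj₁ (inRowSpace i) , inside-span i
    ; spanning    = λ i → proj₁ (spanning i) , spans i
    }
    where
    open RowSpaceBasis B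
    inside-span : ∀ i (j : Fin (suc n)) → pad vectors i j ≡ lincomb (proj₁ (inRowSpace i)) V j
    inside-span i zero    = sym (lincomb-zeros (proj₁ (inRowSpace i)) (λ k → V k zero) V≡0)
    inside-span i (suc j) = proj₂ (inRowSpace i) j
    spans : ∀ i (j : Fin (suc n)) → V i j ≡ lincomb (proj₁ (spanning i)) (pad vectors) j
    spans i zero    = trans (V≡0 i) (sym (lincomb-zeros (proj₁ (spanning i)) _ λ _ → refl))
    spans i (suc j) = proj₂ (spanning i) j

  module Eliminate {m n : ℕ} (V : Matrix ℚ m (suc n)) (a : Fin m) (≢0 : V a zero ≢ 0ℚ) where
    p : ℚ
    p = V a zero

    instance
      p-nonZero : ℚ.NonZero p
      p-nonZero = ℚ.≢-nonZero ≢0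

    t : Vector ℚ m
    t i = V i zero ℚ.* ℚ.1/ p

    t-pivot : ∀ i → t i ℚ.* p ≡ V i zero
    t-pivot i = begin
      V i zero ℚ.* ℚ.1/ p ℚ.* p   ≡⟨ ℚ.*-assoc (V i zero) (ℚ.1/ p) p ⟩
      V i zero ℚ.* (ℚ.1/ p ℚ.* p) ≡⟨ cong (V i zero ℚ.*_) (ℚ.*-inverseˡ p) ⟩
      V i zero ℚ.* 1ℚ             ≡⟨ ℚ.*-identityʳ (V i zero) ⟩
      V i zero                    ∎

    W : Matrix ℚ m (suc n)
    W i j = V i j ℚ.+ ℚ.- (t i ℚ.* V a j)

    W-zero : ∀ i → W i zero ≡ 0ℚ
    W-zero i = trans (cong (λ x → V i zero ℚ.+ ℚ.- x) (t-pivot i)) (ℚ.+-inverseʳ (V i zero))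

    module _ (B : RowSpaceBasis (λ i j → W i (suc j))) where
      open RowSpaceBasis B

      vectors′ : Matrix ℚ (suc size) (suc n)
      vectors′ zero    = V a
      vectors′ (suc i) = pad vectors i

      head-zero : ∀ c → (∀ j → lincomb c vectors′ j ≡ 0ℚ) → c zero ≡ 0ℚ
      head-zero c h = begin
        c zero                      ≡⟨ ℚ.*-identityʳ (c zero) ⟨
        c zero ℚ.* 1ℚ               ≡⟨ cong (c zero ℚ.*_) (ℚ.*-inverseʳ p) ⟨
        c zero ℚ.* (p ℚ.* ℚ.1/ p)   ≡⟨ ℚ.*-assoc (c zero) p (ℚ.1/ p) ⟨
        c zero ℚ.* p ℚ.* ℚ.1/ p     ≡⟨ cong (ℚ._* ℚ.1/ p) (begin
          c zero ℚ.* p                  ≡⟨ ℚ.+-identityʳ (c zero ℚ.* p) ⟨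
          c zero ℚ.* p ℚ.+ 0ℚ           ≡⟨ cong (c zero ℚ.* p ℚ.+_)
                                             (lincomb-zeros (c ∘ suc) (λ i → pad vectors i zero)
                                               λ _ → refl) ⟨
          lincomb c vectors′ zero       ≡⟨ h zero ⟩
          0ℚ                            ∎) ⟩
        0ℚ ℚ.* ℚ.1/ p               ≡⟨ ℚ.*-zeroˡ (ℚ.1/ p) ⟩
        0ℚ                          ∎

      independent′ : Independent vectors′
      independent′ c h zero    = head-zero c h
      independent′ c h (suc i) = independent (c ∘ suc) (λ j → begin
        s j                                   ≡⟨ ℚ.+-identityˡ (s j) ⟨
        0ℚ ℚ.+ s j                            ≡⟨ cong (ℚ._+ s j) (ℚ.*-zeroˡ (V a (suc j))) ⟨
        0ℚ ℚ.* V a (suc j) ℚ.+ s j            ≡⟨ cong (λ x → x ℚ.* V a (suc j) ℚ.+ s j)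
                                                   (head-zero c h) ⟨
        c zero ℚ.* V a (suc j) ℚ.+ s j        ≡⟨ h (suc j) ⟩
        0ℚ                                    ∎) i
        where s = lincomb (c ∘ suc) vectors

      -- Rewriting a combination of the reduced rows as one of the original rows.
      module _ (μ : Vector ℚ m) where
        τ : ℚ
        τ = ℚΣ.sum (λ k → μ k ℚ.* t k)

        ν : Vector ℚ m
        ν k = μ k ℚ.+ (ℚ.- τ) ℚ.* unitVector a k

        unreduce : ∀ j → lincomb μ W j ≡ lincomb ν V j
        unreduce j = begin
          ℚΣ.sum (λ k → μ k ℚ.* (V k j ℚ.+ ℚ.- (t k ℚ.* v)))
            ≡⟨ ℚΣ.sum-cong-≗ (λ k → solve 4
                 (λ x y z w → x :* (y :+ :- (z :* w)) := x :* y :+ (x :* z) :* (:- w))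
                 refl (μ k) (V k j) (t k) v) ⟩
          ℚΣ.sum (λ k → μ k ℚ.* V k j ℚ.+ μ k ℚ.* t k ℚ.* (ℚ.- v))
            ≡⟨ ℚΣ.∑-distrib-+ (λ k → μ k ℚ.* V k j) (λ k → μ k ℚ.* t k ℚ.* (ℚ.- v)) ⟩
          S ℚ.+ ℚΣ.sum (λ k → μ k ℚ.* t k ℚ.* (ℚ.- v))
            ≡⟨ cong (S ℚ.+_) (ℚΣ.*-distribʳ-sum (ℚ.- v) (λ k → μ k ℚ.* t k)) ⟨
          S ℚ.+ τ ℚ.* (ℚ.- v)
            ≡⟨ cong (S ℚ.+_) (solve 2 (λ x y → x :* (:- y) := (:- x) :* y) refl τ v) ⟩
          S ℚ.+ (ℚ.- τ) ℚ.* v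
            ≡⟨ cong (λ x → S ℚ.+ (ℚ.- τ) ℚ.* x) (unit-select a (λ k → V k j)) ⟨
          S ℚ.+ (ℚ.- τ) ℚ.* ℚΣ.sum (λ k → unitVector a k ℚ.* V k j)
            ≡⟨ cong (S ℚ.+_) (ℚΣ.*-distribˡ-sum (ℚ.- τ) (λ k → unitVector a k ℚ.* V k j)) ⟩
          S ℚ.+ ℚΣ.sum (λ k → (ℚ.- τ) ℚ.* (unitVector a k ℚ.* V k j))
            ≡⟨ ℚΣ.∑-distrib-+ (λ k → μ k ℚ.* V k j)
                              (λ k → (ℚ.- τ) ℚ.* (unitVector a k ℚ.* V k j)) ⟨
          ℚΣ.sum (λ k → μ k ℚ.* V k j ℚ.+ (ℚ.- τ) ℚ.* (unitVector a k ℚ.* V k j))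
            ≡⟨ ℚΣ.sum-cong-≗ (λ k → solve 4
                 (λ x y z w → x :* w :+ y :* (z :* w) := (x :+ y :* z) :* w)
                 refl (μ k) (ℚ.- τ) (unitVector a k) (V k j)) ⟩
          ℚΣ.sum (λ k → ν k ℚ.* V k j) ∎
          where
          v = V a j
          S = ℚΣ.sum (λ k → μ k ℚ.* V k j)

      inRowSpace′ : ∀ i → vectors′ i ∈span V
      inRowSpace′ zero    = unitVector a , λ j → sym (unit-select a (λ k → V k j))
      inRowSpace′ (suc i) = ν μ , λ j → trans (reduced j) (unreduce μ j)
        where
        μ = proj₁ (inRowSpace i)
        reduced : ∀ j → pad vectors i j ≡ lincomb μ W j
        reduced zero    = sym (lincomb-zeros μ (λ k → W k zero) W-zero)
        reduced (suc j) = proj₂ (inRowSpace i) j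

      spanning′ : ∀ i → V i ∈span vectors′
      spanning′ i = c , spans
        where
        μ = proj₁ (spanning i)
        c : Vector ℚ (suc size)
        c zero    = t i
        c (suc k) = μ k
        spans : ∀ j → V i j ≡ lincomb c vectors′ j
        spans zero = begin
          V i zero                        ≡⟨ t-pivot i ⟨
          t i ℚ.* p                       ≡⟨ ℚ.+-identityʳ (t i ℚ.* p) ⟨
          t i ℚ.* p ℚ.+ 0ℚ                ≡⟨ cong (t i ℚ.* p ℚ.+_)
                                               (lincomb-zeros μ (λ k → pad vectors k zero)
                                                 λ _ → refl) ⟨
          lincomb c vectors′ zero         ∎
        spans (suc j) = begin
          V i (suc j)                                   ≡⟨ solve 2 (λ x y → x := y :+ (x :+ :- y)) refl
                                                             (V i (suc j)) (t i ℚ.* V a (suc j)) ⟩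
          t i ℚ.* V a (suc j) ℚ.+ W i (suc j)           ≡⟨ cong (t i ℚ.* V a (suc j) ℚ.+_)
                                                             (proj₂ (spanning i) j) ⟩
          lincomb c vectors′ (suc j)                    ∎

      basis : RowSpaceBasis V
      basis = record
        { size        = suc size
        ; vectors     = vectors′
        ; independent = independent′
        ; inRowSpace  = inRowSpace′
        ; spanning    = spanning′
        }

  rowSpaceBasis : {m n : ℕ} (V : Matrix ℚ m n) → RowSpaceBasis V
  rowSpaceBasis {m} {zero} V = record
    { size        = 0
    ; vectors     = λ ()
    ; independent = λ _ _ ()
    ; inRowSpace  = λ ()
    ; spanning    = λ _ → (λ ()) , λ ()
    }
  rowSpaceBasis {m} {suc n} V with any? (λ i → ¬? (V i zero ℚ.≟ 0ℚ))
  ... | yes (a , ≢0) = Eliminate.basis V a ≢0 (rowSpaceBasis _)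
  ... | no all-zero  = basis-zero-column V
    (λ i → decidable-stable (V i zero ℚ.≟ 0ℚ) λ ≢0 → all-zero (i , ≢0))
    (rowSpaceBasis _)

------------------------------------------------------------------------

rank : {m n : ℕ} → Matrix ℤ m n → ℕ
rank C = RowSpaceBasis.size (rowSpaceBasis λ i j → C i j ℚ./ 1)

invariantFactors : {m n : ℕ} → Matrix ℤ m n → List ℕ
invariantFactors C = SmithForm.factors (smith C)

-- One-based lookup, extended by 1 at index 0 and by 0 past the end.
nth : List ℕ → ℕ → ℕ
nth ds       0             = 1
nth []       (suc _)       = 0
nth (d ∷ _)  1             = d
nth (_ ∷ ds) (suc (suc j)) = nth ds (suc j)

-- The list 1, 2, …, k.
range : ℕ → List ℕ
range k = List.map suc (upTo k)

infix 4 _≅_[mod_] _≅?_[mod_]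
_≅_[mod_] : ℤ → ℤ → ℕ → Set
x ≅ y [mod q ] = + q ℤ∣.∣ x ℤ.- y

_≅?_[mod_] : (x y : ℤ) (q : ℕ) → Dec (x ≅ y [mod q ])
x ≅? y [mod q ] = + q ℤ∣.∣? (x ℤ.- y)

-- All vectors of length n with entries from xs.
allVectors : {X : Set} → List X → (n : ℕ) → List (Vec X n)
allVectors xs zero    = Vec.[] ∷ []
allVectors xs (suc n) = cartesianProductWith Vec._∷_ xs (allVectors xs n)

subsets : (m : ℕ) → List (Subset m)
subsets = allVectors (inside ∷ outside ∷ [])

-- Increasing enumeration of the elements of J.
element : {m : ℕ} (J : Subset m) → Fin ∣ J ∣ → Fin m
element (inside  Vec.∷ J) zero    = zero
element (inside  Vec.∷ J) (suc i) = suc (element J i)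
element (outside Vec.∷ J) i       = suc (element J i)

infix 5 ∑[_]_
∑[_]_ : {X : Set} → List X → (X → ℤ) → ℤ
∑[ xs ] f = foldr ℤ._+_ 0ℤ (List.map f xs)

-- Elements of (ℤ/q)ⁿ are given by their representatives in {0, …, q - 1},
-- and equality in ℤ/q is congruence modulo q.
Point : ℕ → ℕ → Set
Point q n = Vec (Fin q) n

infix 7 _•_
_•_ : {n q : ℕ} → Vector ℤ n → Point q n → ℤ
α • x = ℤΣ.sum λ j → α j ℤ.* + toℕ (Vec.lookup x j)

module Arrangement {m n l : ℕ}
  (A : Matrix ℤ m n) (a : Vector ℤ m) (B : Matrix ℤ l n) (b : Vector ℤ l) where

  InV : (q : ℕ) → Point q n → Set
  InV q x = ∀ k → B k • x ≅ b k [mod q ]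

  InH : Fin m → (q : ℕ) → Point q n → Set
  InH i q x = InV q x × A i • x ≅ a i [mod q ]

  InM : (q : ℕ) → Point q n → Set
  InM q x = InV q x × ¬ ∃ λ i → InH i q x

  inV? : (q : ℕ) (x : Point q n) → Dec (InV q x)
  inV? q x = all? λ k → (B k • x) ≅? b k [mod q ]

  inM? : (q : ℕ) (x : Point q n) → Dec (InM q x)
  inM? q x = inV? q x ×-dec ¬? (any? λ i → inV? q x ×-dec (A i • x) ≅? a i [mod q ])

  #M : ℕ → ℕ
  #M q = length (filter (inM? q) (allVectors (allFin q) n))

  C : (J : Subset m) → Matrix ℤ (l ℕ.+ ∣ J ∣) n
  C J = B Vector.++ (A ∘ element J)

  c : (J : Subset m) → Vector ℤ (l ℕ.+ ∣ J ∣)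
  c J = b Vector.++ (a ∘ element J)

  C̄ : (J : Subset m) → Matrix ℤ (l ℕ.+ ∣ J ∣) (n ℕ.+ 1)
  C̄ J i = C J i Vector.++ (c J i Vector.∷ Vector.[])

  r : Subset m → ℕ
  r J = rank (C J)

  r̄ : Subset m → ℕ
  r̄ J = rank (C̄ J)

  d : Subset m → ℕ → ℕ
  d J = nth (invariantFactors (C J))

  d̄ : Subset m → ℕ → ℕ
  d̄ J = nth (invariantFactors (C̄ J))

  consistent : List (Subset m)
  consistent = filter (λ J → r̄ J ℕ.≟ r J) (subsets m)

  inconsistent : List (Subset m)
  inconsistent = filter (λ J → r̄ J ℕ.≟ r J ℕ.+ 1) (subsets m)

  ρC : ℕ
  ρC = foldr lcm 1 (List.map (λ J → d J (r J)) consistent)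

  q₀ : ℕ
  q₀ = foldr _⊔_ 0 (List.map (λ J → d̄ J (r̄ J)) inconsistent)

  dProd : Subset m → ℕ → ℕ
  dProd J q = product (List.map (λ j → gcd (d J j) q) (range (r J)))

  -- C J has exactly r J invariant factors, so when r̄ J = r J + 1 the convention
  -- d J (r̄ J) = 0 is supplied by nth.
  d̃ : Subset m → ℕ → ℕ
  d̃ J q = if does (All.all? (λ j → gcd q (d J j) ℕ.≟ gcd q (d̄ J j)) (range (r̄ J)))
          then dProd J q else 0

  term : ℕ → Subset m → ℤ
  term q J = -1ℤ ℤ.^ ∣ J ∣ ℤ.* + (d̃ J q ℕ.* q ℕ.^ (n ℕ.∸ r J))

-- Coefficient lists, constant term first.
Polynomial : Set
Polynomial = List ℚ

eval : Polynomial → ℚ → ℚ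
eval cs t = foldr (λ c v → c ℚ.+ t ℚ.* v) 0ℚ cs

record IsQuasiPolynomial (f : ℕ → ℚ) (ρ : ℕ) : Set where
  field
    period-positive : 0 < ρ
    constituent     : Fin ρ → Polynomial
    agrees          : ∀ q → 0 < q → ∀ j → + q ≅ + suc (toℕ j) [mod ρ ] →
                      f q ≡ eval (constituent j) (+ q ℚ./ 1)

{-# OPTIONS --safe #-}
-- A matrix modulo a divisor e of its (j+1)-st invariant factor factors through rank j, so
-- any j+1 combinations of its rows admit a primitive dependence modulo e (kernel-mod).
-- Applied to X ≡ Y R this shows that the invariant factors of Y divide those of X; with
-- X = C and Y = [C c], and with the roles exchanged when C x ≡ c modulo q is solvable, it
-- compares gcd(q, d_j) with gcd(q, d̄_j).  Conversely, equality of the gcds forces, one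
-- index after the other, each gcd(q, d_i) to divide the i-th entry of P c, where P C Q is
-- the Smith form, and then the diagonal system is solvable and its solutions are counted
-- factor by factor.  Inclusion–exclusion over J gives the formula for #M; it is
-- quasi-polynomial on consistent J since all gcds there only depend on q modulo ρC, and
-- for inconsistent J the last gcd condition reads q = gcd(q, d̄), impossible for q > q₀.
module Submission where

open import Defs
open import Data.Integer.Base using (ℤ; +_)
open import Data.Nat.Base using (ℕ; _<_)
open import Data.Product.Base using (Σ; _×_)
open import Data.Rational.Base using (ℚ; _/_)
open import Data.Vec.Functional using (Vector)
open import Relation.Binary.PropositionalEquality using (_≡_)

open import Data.Bool.Base using (if_then_else_)
open import Data.Fin.Base as Fin using (Fin; zero; suc; toℕ; fromℕ<; inject≤; _↑ˡ_; _↑ʳ_)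
import Data.Fin.Properties as Fin
open import Data.Fin.Subset using (Subset; inside; outside; ∣_∣)
open import Data.Integer.Base as ℤ using (0ℤ; 1ℤ; -1ℤ)
open import Data.Integer.Divisibility.Signed
  using (_∣_; divides; ∣m∣n⇒∣m+n; ∣m⇒∣m*n; ∣n⇒∣m*n; ∣m+n∣m⇒∣n; ∣m+n∣n⇒∣m; ∣m⇒∣-m;
         ∣-trans; ∣ᵤ⇒∣; ∣⇒∣ᵤ; *-cancelˡ-∣)
import Data.Integer.DivMod as ℤ
import Data.Integer.Properties as ℤ
import Data.Integer.Solver as ℤSolver
open import Data.List.Base as List
  using (List; []; _∷_; _++_; length; filter; foldr; map; allFin; cartesianProductWith)
open import Data.List.Membership.Propositional using (_∈_)
open import Data.List.Membership.Propositional.Properties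
  using (∈-filter⁺; ∈-filter⁻; ∈-map⁺; ∈-map⁻; ∈-allFin; ∈-cartesianProductWith⁺;
         ∈-cartesianProductWith⁻)
open import Data.List.Membership.Propositional.Properties.WithK using (unique∧set⇒bag)
import Data.List.Properties as List
open import Data.List.Relation.Binary.BagAndSetEquality using (∼bag⇒↭)
open import Data.List.Relation.Binary.Permutation.Propositional.Properties using (↭-length)
open import Data.List.Relation.Unary.All as All using (All; []; _∷_)
import Data.List.Relation.Unary.All.Properties as All
open import Data.List.Relation.Unary.AllPairs using ([]; _∷_)
open import Data.List.Relation.Unary.Any using (here; there)
open import Data.List.Relation.Unary.Linked using (Linked; []; [-]; _∷_)
open import Data.List.Relation.Unary.Unique.Propositional using (Unique)
import Data.List.Relation.Unary.Unique.Propositional.Properties as Unique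
open import Data.Nat.Base as ℕ using (zero; suc; _≤_; z≤n; s≤s)
import Data.Nat.Divisibility as ℕ∣
import Data.Nat.DivMod as ℕ
open import Data.Nat.GCD
  using (gcd; gcd[m,n]∣m; gcd[m,n]∣n; gcd-greatest; gcd-GCD; gcd-comm; gcd-identityʳ;
         gcd[m,n]≡0⇒n≡0; c*gcd[m,n]≡gcd[cm,cn]; module Bézout)
open import Data.Nat.Induction using (<-rec)
open import Data.Nat.LCM using (lcm; m∣lcm[m,n]; n∣lcm[m,n]; lcm-least)
open import Data.Nat.ListAction using (product)
import Data.Nat.Properties as ℕ
open import Data.Product.Base using (∃; ∃₂; _,_; proj₁; proj₂)
open import Data.Rational.Base as ℚ using (0ℚ; 1ℚ; mkℚ)
import Data.Rational.Properties as ℚ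
import Data.Rational.Solver as ℚSolver
import Data.Rational.Unnormalised.Base as ℚᵘ
import Data.Rational.Unnormalised.Properties as ℚᵘ
open import Data.Sum.Base using (inj₁; inj₂)
import Data.Vec.Base as Vec
open import Data.Vec.Functional as Vector using ()
import Data.Vec.Functional.Properties as Vector
import Data.Vec.Properties as Vec
open import Function.Base using (_∘_)
open import Function.Bundles using (_⇔_; mk⇔)
open import Relation.Binary.PropositionalEquality
  using (_≢_; refl; sym; trans; cong; cong₂; subst; subst₂; module ≡-Reasoning)
open import Relation.Nullary.Decidable using (does-⇔; dec-false)
open import Relation.Nullary.Decidable.Core using (Dec; does; yes; no; ¬?)
open import Relation.Nullary.Negation.Core using (¬_; contradiction)
open import Relation.Unary using (Decidable)

open Bézout using (+-; -+)
open ℤSolver.+-*-Solver using (solve; _:=_; _:+_; _:*_; _:-_; :-_; con)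
open ≡-Reasoning

-- Divisibility

-- The obstacle is that ℤ/e has zero divisors, so a dependence that is merely nonzero says little. A
-- primitive one still works: if Σ wᵢ uᵢ = 1 and e divides every wᵢ x, then e divides x. Such a w is
-- a row of the unimodular P of a Smith form, and u is the matching column of P⁻¹. Solvability of C
-- x ≡ c is not visible from C alone. After x = Q y the system is diagonal with right-hand side P c,
-- and it is solvable exactly when gcd(q, dᵢ) divides the i-th entry of P c for every row i, with dᵢ
-- = 0 past the rank. These entries depend on the chosen P, while the theorem speaks only of the
-- invariant factors of [C c]; `gcds-divide` bridges this gap. Agreement of the gcds amounts to two
-- divisibilities. One, d̄ⱼ ∣ dⱼ, always holds, because deleting a column is a right multiplication;
-- the real condition is gcd(q, dⱼ) ∣ d̄ⱼ. Ranks come from elimination and invariant factors from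
-- Smith forms. They meet in `rank≡length`, which locates the first zero among the dⱼ and thereby
-- gives the last gcd condition of an inconsistent J its form.

∣-isolate : {n : ℕ} {e : ℤ} (f : Vector ℤ n) (i : Fin n) →
            (∀ j → j ≢ i → e ∣ f j) → e ∣ ℤΣ.sum f → e ∣ f i
∣-isolate f zero    others s =
  ∣m+n∣n⇒∣m s (∣-sum (f ∘ suc) λ j → others (suc j) λ ())
∣-isolate f (suc i) others s =
  ∣-isolate (f ∘ suc) i (λ j j≢i → others (suc j) (j≢i ∘ Fin.suc-injective))
    (∣m+n∣m⇒∣n s (others zero λ ()))

∣0 : {e : ℤ} → e ∣ 0ℤ
∣0 = divides 0ℤ refl

∣-≡ : {e x y : ℤ} → x ≡ y → e ∣ x → e ∣ y
∣-≡ refl e∣x = e∣x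

∣-transfer : {e x y : ℤ} → e ∣ x ℤ.- y → e ∣ y → e ∣ x
∣-transfer {x = x} {y} p q =
  ∣-≡ (solve 2 (λ x y → (x :- y) :+ y := x) refl x y) (∣m∣n⇒∣m+n p q)

∣-sum-transfer : {n : ℕ} {e : ℤ} (f g : Vector ℤ n) → (∀ i → e ∣ f i ℤ.- g i) →
                 e ∣ ℤΣ.sum g → e ∣ ℤΣ.sum f
∣-sum-transfer f g p = ∣-transfer (sums f g p)
  where
  sums : {n : ℕ} {e : ℤ} (f g : Vector ℤ n) → (∀ i → e ∣ f i ℤ.- g i) →
         e ∣ ℤΣ.sum f ℤ.- ℤΣ.sum g
  sums {zero}  f g p = ∣0
  sums {suc n} f g p = ∣-≡
    (solve 4 (λ a b c d → (a :- b) :+ (c :- d) := (a :+ c) :- (b :+ d)) refl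
      (f zero) (g zero) (ℤΣ.sum (f ∘ suc)) (ℤΣ.sum (g ∘ suc)))
    (∣m∣n⇒∣m+n (p zero) (sums (f ∘ suc) (g ∘ suc) (p ∘ suc)))

*-∣-difference : {e x y : ℤ} (k : ℤ) → e ∣ x ℤ.- y → e ∣ k ℤ.* x ℤ.- k ℤ.* y
*-∣-difference {x = x} {y} k p =
  ∣-≡ (solve 3 (λ k x y → k :* (x :- y) := k :* x :- k :* y) refl k x y) (∣n⇒∣m*n k p)

-- Multiplying the relation certified by `u` by `x` writes `x` as a combination of the `w i * x`.
-- This replaces cancelling a nonzero `w i`, which fails modulo a composite `e`.
∣-primitive : {n : ℕ} {e : ℤ} (w u : Vector ℤ n) → ℤΣ.sum (λ i → w i ℤ.* u i) ≡ 1ℤ →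
              (x : ℤ) → (∀ i → e ∣ w i ℤ.* x) → e ∣ x
∣-primitive w u wu x h = ∣-≡
  (begin
    ℤΣ.sum (λ i → w i ℤ.* u i ℤ.* x)   ≡⟨ ℤΣ.*-distribʳ-sum x (λ i → w i ℤ.* u i) ⟨
    ℤΣ.sum (λ i → w i ℤ.* u i) ℤ.* x   ≡⟨ cong (ℤ._* x) wu ⟩
    1ℤ ℤ.* x                           ≡⟨ ℤ.*-identityˡ x ⟩
    x                                  ∎)
  (∣-sum _ λ i → ∣-≡ (solve 3 (λ w u x → u :* (w :* x) := w :* u :* x) refl (w i) (u i) x)
                     (∣n⇒∣m*n (u i) (h i)))

-- Diagonal matrices and divisor chains

diag-on : {m n : ℕ} (ds : List ℕ) (i : Fin m) (j : Fin n) → toℕ i ≡ toℕ j →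
          diag ds i j ≡ + nth ds (suc (toℕ i))
diag-on []       i       j       eq = refl
diag-on (d ∷ ds) zero    zero    eq = refl
diag-on (d ∷ ds) (suc i) (suc j) eq = diag-on ds i j (ℕ.suc-injective eq)

diag-off : {m n : ℕ} (ds : List ℕ) (i : Fin m) (j : Fin n) → toℕ i ≢ toℕ j →
           diag ds i j ≡ 0ℤ
diag-off []       i       j       i≢j = refl
diag-off (d ∷ ds) zero    zero    i≢j = contradiction refl i≢j
diag-off (d ∷ ds) zero    (suc j) i≢j = refl
diag-off (d ∷ ds) (suc i) zero    i≢j = refl
diag-off (d ∷ ds) (suc i) (suc j) i≢j = diag-off ds i j (i≢j ∘ cong suc)

nth-beyond : (ds : List ℕ) {j : ℕ} → length ds ≤ j → nth ds (suc j) ≡ 0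
nth-beyond []       _       = refl
nth-beyond (d ∷ ds) (s≤s p) = nth-beyond ds p

-- Past the end `nth` is zero, which everything divides, so the chain extends to all indices.
nth-chain : {ds : List ℕ} → Linked ℕ∣._∣_ ds → ∀ {i j} → i ≤ j →
            nth ds (suc i) ℕ∣.∣ nth ds (suc j)
nth-chain []      {i} {j} z≤n             = ℕ∣._∣0 _
nth-chain []      (s≤s p)                 = ℕ∣._∣0 _
nth-chain {d ∷ ds} l {zero} {zero} p      = ℕ∣.∣-refl
nth-chain [-]     {zero} {suc j} p        = ℕ∣._∣0 _
nth-chain (p ∷ l) {zero} {suc j} _        = ℕ∣.∣-trans p (nth-chain l {zero} {j} z≤n)
nth-chain [-]     {suc i} {suc j} (s≤s p) = ℕ∣._∣0 _
nth-chain (_ ∷ l) {suc i} {suc j} (s≤s p) = nth-chain l p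

∣-diag : {m n e : ℕ} {ds : List ℕ} → Linked ℕ∣._∣_ ds → ∀ {j} → e ℕ∣.∣ nth ds (suc j) →
         (a : Fin m) (c : Fin n) → j ≤ toℕ a → + e ∣ diag ds a c
∣-diag {ds = ds} l e∣d a c j≤a with toℕ a ℕ.≟ toℕ c
... | yes eq = subst (_ ∣_) (sym (diag-on ds a c eq)) (∣ᵤ⇒∣ (ℕ∣.∣-trans e∣d (nth-chain l j≤a)))
... | no neq = subst (_ ∣_) (sym (diag-off ds a c neq)) ∣0

Id-diagonal : {n : ℕ} (i : Fin n) → Id i i ≡ 1ℤ
Id-diagonal zero    = refl
Id-diagonal (suc i) = Id-diagonal i

-- Kernels

row : {n : ℕ} → Vector ℤ n → Matrix ℤ 1 n
row w _ = w

module _ {m n : ℕ} {C : Matrix ℤ m n} (S : SmithForm C) where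
  open SmithForm S
  open Unimodular P-unimodular renaming (inverse to P⁻¹; inverseˡ to P⁻¹P)
  open Unimodular Q-unimodular renaming (inverse to Q⁻¹; inverseʳ to QQ⁻¹)

  P·C : P · C ≐ diag factors · Q⁻¹
  P·C i j = begin
    (P · C) i j               ≡⟨ ·-identityʳ (P · C) i j ⟨
    (P · C · Id) i j          ≡⟨ ·-congˡ (P · C) QQ⁻¹ i j ⟨
    (P · C · (Q · Q⁻¹)) i j   ≡⟨ ·-assoc (P · C) Q Q⁻¹ i j ⟨
    (P · C · Q · Q⁻¹) i j     ≡⟨ ·-congʳ Q⁻¹ diagonal i j ⟩
    (diag factors · Q⁻¹) i j  ∎

  C-factored : C ≐ P⁻¹ · (diag factors · Q⁻¹)
  C-factored i j = begin
    C i j                               ≡⟨ ·-identityˡ C i j ⟨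
    (Id · C) i j                        ≡⟨ ·-congʳ C P⁻¹P i j ⟨
    (P⁻¹ · P · C) i j                   ≡⟨ ·-assoc P⁻¹ P C i j ⟩
    (P⁻¹ · (P · C)) i j                 ≡⟨ ·-congˡ P⁻¹ P·C i j ⟩
    (P⁻¹ · (diag factors · Q⁻¹)) i j    ∎

-- In P U = D Q⁻¹ the diagonal matrix D has only t columns, so its row of index t vanishes. Row t of
-- P is therefore a left kernel vector of U, and column t of P⁻¹ certifies that it is primitive.
kernel : {s t : ℕ} → t < s → (U : Matrix ℤ s t) → ∃₂ λ (w u : Vector ℤ s) →
         ℤΣ.sum (λ i → w i ℤ.* u i) ≡ 1ℤ × (∀ j → ℤΣ.sum (λ i → w i ℤ.* U i j) ≡ 0ℤ)
kernel {s} {t} t<s U =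
  P r , (λ i → P⁻¹ i r) , trans (PP⁻¹ r r) (Id-diagonal r) ,
  λ j → trans (P·C (smith U) r j) (sum-zero _ λ c → trans
    (cong (ℤ._* Q⁻¹ c j) (diag-off factors r c
      λ eq → ℕ.<⇒≢ (Fin.toℕ<n c) (trans (sym eq) (Fin.toℕ-fromℕ< t<s))))
    (ℤ.*-zeroˡ (Q⁻¹ c j)))
  where
  open SmithForm (smith U)
  open Unimodular P-unimodular renaming (inverse to P⁻¹; inverseʳ to PP⁻¹)
  open Unimodular Q-unimodular using () renaming (inverse to Q⁻¹)
  r : Fin s
  r = fromℕ< t<s

-- Reading a vector as zero past its end lets `kernel-mod` take the first j columns of a matrix that
-- may have fewer.
extend : {n : ℕ} → Vector ℤ n → ℕ → ℤ
extend {zero}  v _       = 0ℤ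
extend {suc n} v zero    = v zero
extend {suc n} v (suc i) = extend (v ∘ suc) i

extend-toℕ : {n : ℕ} (v : Vector ℤ n) (i : Fin n) → extend v (toℕ i) ≡ v i
extend-toℕ v zero    = refl
extend-toℕ v (suc i) = extend-toℕ (v ∘ suc) i

-- Modulo a divisor e of the (j+1)-st invariant factor, C has at most j nonzero
-- invariant factors, so any j+1 combinations of its rows are dependent.
kernel-mod : {m n : ℕ} {C : Matrix ℤ m n} (S : SmithForm C) {e j : ℕ} →
             e ℕ∣.∣ nth (SmithForm.factors S) (suc j) → (L : Matrix ℤ (suc j) m) →
             ∃₂ λ (w u : Vector ℤ (suc j)) → ℤΣ.sum (λ i → w i ℤ.* u i) ≡ 1ℤ ×
               (∀ c → + e ∣ ℤΣ.sum (λ i → w i ℤ.* (L · C) i c))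
kernel-mod {m} {n} {C} S {e} {j} e∣d L = w , u , wu , divisible
  where
  open SmithForm S
  open Unimodular P-unimodular using () renaming (inverse to P⁻¹)
  open Unimodular Q-unimodular using () renaming (inverse to Q⁻¹)
  -- L C = T D Q⁻¹. A combination that kills the first j columns of `T` avoids the first j diagonal
  -- entries; all later ones are divisible by e.
  T : Matrix ℤ (suc j) m
  T = L · P⁻¹
  ker = kernel (ℕ.n<1+n j) (λ i (b : Fin j) → extend (T i) (toℕ b))
  w = proj₁ ker
  u = proj₁ (proj₂ ker)
  wu = proj₁ (proj₂ (proj₂ ker))
  wT≡0 : ∀ a → toℕ a < j → (row w · T) zero a ≡ 0ℤ
  wT≡0 a a<j = trans
    (ℤΣ.sum-cong-≗ λ i → cong (w i ℤ.*_) (trans (sym (extend-toℕ (T i) a))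
      (cong (extend (T i)) (sym (Fin.toℕ-fromℕ< a<j)))))
    (proj₂ (proj₂ (proj₂ ker)) (fromℕ< a<j))
  wTD : ∀ a c → + e ∣ (row w · T) zero a ℤ.* diag factors a c
  wTD a c with toℕ a ℕ.<? j
  ... | yes a<j = subst (_ ∣_) (sym (trans (cong (ℤ._* diag factors a c) (wT≡0 a a<j))
                    (ℤ.*-zeroˡ (diag factors a c)))) ∣0
  ... | no a≮j = ∣n⇒∣m*n ((row w · T) zero a) (∣-diag chain e∣d a c (ℕ.≮⇒≥ a≮j))
  LC : row w · (L · C) ≐ row w · T · diag factors · Q⁻¹
  LC i c = begin
    (row w · (L · C)) i c                            ≡⟨ ·-congˡ (row w) (·-congˡ L (C-factored S)) i c ⟩
    (row w · (L · (P⁻¹ · (diag factors · Q⁻¹)))) i c ≡⟨ ·-congˡ (row w) (·-assoc L P⁻¹ (diag factors · Q⁻¹)) i c ⟨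
    (row w · (T · (diag factors · Q⁻¹))) i c         ≡⟨ ·-assoc (row w) T (diag factors · Q⁻¹) i c ⟨
    (row w · T · (diag factors · Q⁻¹)) i c           ≡⟨ ·-assoc (row w · T) (diag factors) Q⁻¹ i c ⟨
    (row w · T · diag factors · Q⁻¹) i c             ∎
  divisible : ∀ c → + e ∣ (row w · (L · C)) zero c
  divisible c = subst (_ ∣_) (sym (LC zero c))
    (∣-sum _ λ b → ∣m⇒∣m*n (Q⁻¹ b c) (∣-sum _ λ a → wTD a b))

-- Let L be the first j + 1 rows of P for X. A primitive w with w L Y ≡ 0 modulo e also gives w L X
-- ≡ 0, and after multiplication by Q its i-th column reads e ∣ wᵢ dᵢ. Each dᵢ divides the last of
-- these factors, so e divides every wᵢ times that last factor, and primitivity removes the wᵢ. With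
-- e a parameter, the lemma serves exact identities as well as congruences modulo a divisor of q.
interlace : {k m n e j : ℕ} {X : Matrix ℤ k m} {Y : Matrix ℤ k n}
            (SX : SmithForm X) (SY : SmithForm Y) (R : Matrix ℤ n m) →
            (∀ i c → X i c ≅ (Y · R) i c [mod e ]) →
            e ℕ∣.∣ nth (SmithForm.factors SY) (suc j) →
            e ℕ∣.∣ nth (SmithForm.factors SX) (suc j)
interlace {k} {m} {n} {e} {j} {X} {Y} SX SY R X≅YR e∣d with length factors ℕ.≤? j
  where open SmithForm SX
... | yes len≤j = subst (_ ℕ∣.∣_) (sym (nth-beyond (SmithForm.factors SX) len≤j)) (e ℕ∣.∣0)
... | no  len≰j = ∣⇒∣ᵤ (∣-primitive w u wu (+ nth factors (suc j)) λ i →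
    ∣-trans (isolated i) (∣-*-chain (w i) (nth-chain chain (ℕ.≤-pred (Fin.toℕ<n i)))))
  where
  open SmithForm SX
  j<len : suc j ≤ length factors
  j<len = ℕ.≰⇒> len≰j
  L : Matrix ℤ (suc j) k
  L i = P (inject≤ i (ℕ.≤-trans j<len length≤rows))
  ker = kernel-mod SY e∣d L
  w = proj₁ ker
  u = proj₁ (proj₂ ker)
  wu = proj₁ (proj₂ (proj₂ ker))
  wLYR : ∀ c → + e ∣ (row w · L · (Y · R)) zero c
  wLYR c = subst (_ ∣_)
    (begin
      (row w · (L · Y) · R) zero c   ≡⟨ ·-congʳ R (·-assoc (row w) L Y) zero c ⟨
      (row w · L · Y · R) zero c     ≡⟨ ·-assoc (row w · L) Y R zero c ⟩
      (row w · L · (Y · R)) zero c   ∎)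
    (∣-sum _ λ b → ∣m⇒∣m*n (R b c) (proj₂ (proj₂ (proj₂ ker)) b))
  wLX : ∀ c → + e ∣ (row w · L · X) zero c
  wLX c = ∣-sum-transfer _ (λ a → (row w · L) zero a ℤ.* (Y · R) a c)
    (λ a → *-∣-difference ((row w · L) zero a) (X≅YR a c)) (wLYR c)
  wD : ∀ c → + e ∣ (row w · (L · X · Q)) zero c
  wD c = subst (_ ∣_)
    (begin
      (row w · L · X · Q) zero c     ≡⟨ ·-congʳ Q (·-assoc (row w) L X) zero c ⟩
      (row w · (L · X) · Q) zero c   ≡⟨ ·-assoc (row w) (L · X) Q zero c ⟩
      (row w · (L · X · Q)) zero c   ∎)
    (∣-sum _ λ b → ∣m⇒∣m*n (Q b c) (wLX b))
  isolated : ∀ i → + e ∣ w i ℤ.* + nth factors (suc (toℕ i))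
  isolated i = subst (λ x → + e ∣ w i ℤ.* x)
    (trans (diagonal (inj i) c) (trans (diag-on factors (inj i) c eq)
      (cong (λ x → + nth factors (suc x)) (Fin.toℕ-inject≤ i _))))
    (∣-isolate (λ i → w i ℤ.* (L · X · Q) i c) i
      (λ i′ i′≢i → subst (λ x → + e ∣ w i′ ℤ.* x)
        (sym (trans (diagonal (inj i′) c) (diag-off factors (inj i′) c
          λ eq′ → i′≢i (Fin.toℕ-injective (trans (sym (Fin.toℕ-inject≤ i′ _))
                          (trans eq′ (Fin.toℕ-inject≤ i _)))))))
        (∣n⇒∣m*n (w i′) ∣0))
      (wD c))
    where
    inj : Fin (suc j) → Fin k
    inj i = inject≤ i (ℕ.≤-trans j<len length≤rows)
    c : Fin m
    c = inject≤ i (ℕ.≤-trans j<len length≤cols)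
    eq : toℕ (inj i) ≡ toℕ c
    eq = trans (Fin.toℕ-inject≤ i _) (sym (Fin.toℕ-inject≤ i _))
  ∣-*-chain : (x : ℤ) {a b : ℕ} → a ℕ∣.∣ b → x ℤ.* + a ∣ x ℤ.* + b
  ∣-*-chain x a∣b with ∣ᵤ⇒∣ {k = + _} {i = + _} a∣b
  ... | divides t eq = divides t (trans (cong (x ℤ.*_) eq)
    (solve 3 (λ x t a → x :* (t :* a) := t :* (x :* a)) refl x t (+ _)))

-- Solvability modulo q

infixl 7 _⊙_
_⊙_ : {m n : ℕ} → Matrix ℤ m n → Vector ℤ n → Vector ℤ m
(M ⊙ v) i = ℤΣ.sum λ j → M i j ℤ.* v j

-- At `C J` and `c J` this unfolds to `C̄ J`, so the results below apply to the arrangement without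
-- conversion.
augment : {m n : ℕ} → Matrix ℤ m n → Vector ℤ m → Matrix ℤ m (n ℕ.+ 1)
augment C c i = C i Vector.++ (c i Vector.∷ Vector.[])

module _ {m n : ℕ} (C : Matrix ℤ m n) (c : Vector ℤ m) where

  augment-left : ∀ i j → augment C c i (j ↑ˡ 1) ≡ C i j
  augment-left i j = Vector.lookup-++ˡ (C i) (c i Vector.∷ Vector.[]) j

  augment-right : ∀ i → augment C c i (n ↑ʳ zero) ≡ c i
  augment-right i = Vector.lookup-++ʳ (C i) (c i Vector.∷ Vector.[]) zero

∣-*-gcd : {e : ℕ} (w : ℤ) (q d : ℕ) → + e ∣ w ℤ.* + q → + e ∣ w ℤ.* + d → + e ∣ w ℤ.* + gcd q d
∣-*-gcd {e} w q d p r = ∣ᵤ⇒∣ (subst (e ℕ∣.∣_)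
  (trans (sym (c*gcd[m,n]≡gcd[cm,cn] ℤ.∣ w ∣ q d)) (sym (ℤ.abs-* w (+ gcd q d))))
  (gcd-greatest (subst (e ℕ∣.∣_) (ℤ.abs-* w (+ q)) (∣⇒∣ᵤ p))
                (subst (e ℕ∣.∣_) (ℤ.abs-* w (+ d)) (∣⇒∣ᵤ r))))

*-monoʳ-∣ : {e x y : ℤ} (w : ℤ) → e ∣ w ℤ.* x → x ∣ y → e ∣ w ℤ.* y
*-monoʳ-∣ {e} {x} w p (divides t refl) =
  ∣-≡ (solve 3 (λ w t x → t :* (w :* x) := w :* (t :* x)) refl w t x) (∣n⇒∣m*n t p)

module _ {m n : ℕ} {C : Matrix ℤ m n} (S : SmithForm C) where
  open SmithForm S

  -- The hypothesis at j yields a primitive w annihilating, modulo g j, j + 1 chosen rows of P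
  -- [C c]. The columns of C give g j ∣ `w (suc l)` times the l-th diagonal entry, hence g j ∣
  -- `w (suc l)` g l because g j also divides q. Since g l divides the relevant entries of P c by
  -- induction, the last column leaves g j ∣ `w zero` (P c)ᵢ. Thus g j divides every coefficient of
  -- w times (P c)ᵢ.
  gcds-divide : (c : Vector ℤ m) (S̄ : SmithForm (augment C c)) (q : ℕ) →
                (∀ j → gcd q (nth factors (suc j)) ℕ∣.∣ nth (SmithForm.factors S̄) (suc j)) →
                ∀ i → + gcd q (nth factors (suc (toℕ i))) ∣ (P ⊙ c) i
  gcds-divide c S̄ q hyp i = <-rec Claim step (toℕ i) i ℕ.≤-refl
    where
    g : ℕ → ℕ
    g j = gcd q (nth factors (suc j))

    -- All rows from j on are included, not only row j: the step for a later row i uses that each g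
    -- l with l < j already divides the i-th entry of P c.
    Claim : ℕ → Set
    Claim j = ∀ i → j ≤ toℕ i → + g j ∣ (P ⊙ c) i

    step : ∀ j → (∀ {l} → l < j → Claim l) → Claim j
    step j rec i j≤i = ∣-primitive w u wu ((P ⊙ c) i) λ where
        zero    → ∣-isolate (λ l → w l ℤ.* (P ⊙ c) (sel l)) zero (λ where
                    zero    0≢0 → contradiction refl 0≢0
                    (suc l) _   → *-monoʳ-∣ (w (suc l)) (w*g l)
                                    (rec (Fin.toℕ<n l) (sel (suc l)) (ℕ.≤-reflexive (sym (toℕ-sel l)))))
                  wc
        (suc l) → *-monoʳ-∣ (w (suc l)) (w*g l)
                    (rec (Fin.toℕ<n l) i (ℕ.≤-trans (ℕ.<⇒≤ (Fin.toℕ<n l)) j≤i))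
      where
      j≤m : j ≤ m
      j≤m = ℕ.≤-trans j≤i (ℕ.<⇒≤ (Fin.toℕ<n i))
      -- Row i joins rows 0, ..., j - 1. Since i ≥ j, it has no diagonal entry in the first j
      -- columns, so column l isolates `w (suc l)`.
      sel : Fin (suc j) → Fin m
      sel zero    = i
      sel (suc l) = inject≤ l j≤m
      toℕ-sel : ∀ l → toℕ (sel (suc l)) ≡ toℕ l
      toℕ-sel l = Fin.toℕ-inject≤ l j≤m
      L : Matrix ℤ (suc j) m
      L = P ∘ sel
      ker = kernel-mod S̄ (hyp j) L
      w = proj₁ ker
      u = proj₁ (proj₂ ker)
      wu = proj₁ (proj₂ (proj₂ ker))
      wc : + g j ∣ ℤΣ.sum (λ l → w l ℤ.* (P ⊙ c) (sel l))
      wc = ∣-≡ (ℤΣ.sum-cong-≗ λ l → cong (w l ℤ.*_) (ℤΣ.sum-cong-≗ λ a →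
             cong (L l a ℤ.*_) (augment-right C c a)))
           (proj₂ (proj₂ (proj₂ ker)) (n ↑ʳ zero))
      wC : ∀ b → + g j ∣ (row w · (L · C)) zero b
      wC b = ∣-≡ (ℤΣ.sum-cong-≗ λ l → cong (w l ℤ.*_) (ℤΣ.sum-cong-≗ λ a →
               cong (L l a ℤ.*_) (augment-left C c a b)))
             (proj₂ (proj₂ (proj₂ ker)) (b ↑ˡ 1))
      wD : ∀ b → + g j ∣ ℤΣ.sum (λ l → w l ℤ.* diag factors (sel l) b)
      wD b = ∣-≡
        (trans (·-assoc (row w) (L · C) Q zero b)
               (ℤΣ.sum-cong-≗ λ l → cong (w l ℤ.*_) (diagonal (sel l) b)))
        (∣-sum _ λ a → ∣m⇒∣m*n (Q a b) (wC a))
      w*d : ∀ l → + g j ∣ w (suc l) ℤ.* + nth factors (suc (toℕ l))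
      w*d l with toℕ l ℕ.<? n
      ... | no l≮n = subst (λ x → + g j ∣ w (suc l) ℤ.* + x)
        (sym (nth-beyond factors (ℕ.≤-trans length≤cols (ℕ.≮⇒≥ l≮n)))) (∣n⇒∣m*n (w (suc l)) ∣0)
      ... | yes l<n = subst (λ x → + g j ∣ w (suc l) ℤ.* x)
        (trans (diag-on factors (sel (suc l)) b (trans (toℕ-sel l) (sym toℕ-b)))
               (cong (λ x → + nth factors (suc x)) (toℕ-sel l)))
        (∣-isolate (λ l → w l ℤ.* diag factors (sel l) b) (suc l) off (wD b))
        where
        b = fromℕ< l<n
        toℕ-b : toℕ b ≡ toℕ l
        toℕ-b = Fin.toℕ-fromℕ< l<n
        vanish : ∀ l′ → toℕ (sel l′) ≢ toℕ b → + g j ∣ w l′ ℤ.* diag factors (sel l′) b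
        vanish l′ neq = subst (λ x → + g j ∣ w l′ ℤ.* x) (sym (diag-off factors (sel l′) b neq))
                          (∣n⇒∣m*n (w l′) ∣0)
        off : ∀ l′ → l′ ≢ suc l → + g j ∣ w l′ ℤ.* diag factors (sel l′) b
        off zero     _   = vanish zero λ eq →
          ℕ.<⇒≢ (ℕ.<-≤-trans (Fin.toℕ<n l) j≤i) (sym (trans eq toℕ-b))
        off (suc l′) neq = vanish (suc l′) λ eq →
          neq (cong suc (Fin.toℕ-injective (trans (sym (toℕ-sel l′)) (trans eq toℕ-b))))
      w*g : ∀ l → + g j ∣ w (suc l) ℤ.* + g (toℕ l)
      w*g l = ∣-*-gcd (w (suc l)) q _
        (∣n⇒∣m*n (w (suc l)) (∣ᵤ⇒∣ (gcd[m,n]∣m q (nth factors (suc j))))) (w*d l)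

-- Rank

ι : ℤ → ℚ
ι x = x / 1

ιᵘ : ∀ x → ℚ.toℚᵘ (ι x) ℚᵘ.≃ ℚᵘ.mkℚᵘ x 0
ιᵘ x = ℚ.toℚᵘ-fromℚᵘ (ℚᵘ.mkℚᵘ x 0)

ι-injective : ∀ {x y} → ι x ≡ ι y → x ≡ y
ι-injective {x} {y} eq
  with ℚᵘ.≃-trans (ℚᵘ.≃-sym (ιᵘ x)) (ℚᵘ.≃-trans (ℚᵘ.≃-reflexive (cong ℚ.toℚᵘ eq)) (ιᵘ y))
... | ℚᵘ.*≡* p = trans (sym (ℤ.*-identityʳ x)) (trans p (ℤ.*-identityʳ y))

ι-+ : ∀ x y → ι (x ℤ.+ y) ≡ ι x ℚ.+ ι y
ι-+ x y = ℚ.toℚᵘ-injective (ℚᵘ.≃-trans (ιᵘ (x ℤ.+ y)) (ℚᵘ.≃-sym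
  (ℚᵘ.≃-trans (ℚ.toℚᵘ-homo-+ (ι x) (ι y)) (ℚᵘ.≃-trans (ℚᵘ.+-cong (ιᵘ x) (ιᵘ y))
    (ℚᵘ.*≡* (solve 2 (λ x y → (x :* con 1ℤ :+ y :* con 1ℤ) :* con 1ℤ := (x :+ y) :* con 1ℤ)
      refl x y))))))

ι-* : ∀ x y → ι (x ℤ.* y) ≡ ι x ℚ.* ι y
ι-* x y = ℚ.toℚᵘ-injective (ℚᵘ.≃-trans (ιᵘ (x ℤ.* y)) (ℚᵘ.≃-sym
  (ℚᵘ.≃-trans (ℚ.toℚᵘ-homo-* (ι x) (ι y)) (ℚᵘ.*-cong (ιᵘ x) (ιᵘ y)))))

ι-sum : {n : ℕ} (f : Vector ℤ n) → ι (ℤΣ.sum f) ≡ ℚΣ.sum (ι ∘ f)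
ι-sum {zero}  f = refl
ι-sum {suc n} f = trans (ι-+ (f zero) _) (cong (ι (f zero) ℚ.+_) (ι-sum (f ∘ suc)))

ι-denominator : ∀ p → ι (ℚ.↧ p) ℚ.* p ≡ ι (ℚ.↥ p)
ι-denominator p@(mkℚ n d-1 _) = ℚ.toℚᵘ-injective
  (ℚᵘ.≃-trans (ℚ.toℚᵘ-homo-* (ι (ℚ.↧ p)) p)
  (ℚᵘ.≃-trans (ℚᵘ.*-congʳ {ℚ.toℚᵘ p} (ιᵘ (ℚ.↧ p)))
  (ℚᵘ.≃-trans
    (ℚᵘ.*≡* (trans (ℤ.*-identityʳ _) (trans (ℤ.*-comm (ℚ.↧ p) n)
      (cong (λ x → n ℤ.* + x) (sym (ℕ.+-identityʳ (suc d-1)))))))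
  (ℚᵘ.≃-sym (ιᵘ n)))))

ιᴹ : {m n : ℕ} → Matrix ℤ m n → Matrix ℚ m n
ιᴹ M i j = ι (M i j)

ι-· : {k m n : ℕ} (M : Matrix ℤ k m) (N : Matrix ℤ m n) →
      ∀ i j → ιᴹ (M · N) i j ≡ lincomb (ιᴹ M i) (ιᴹ N) j
ι-· M N i j = trans (ι-sum λ a → M i a ℤ.* N a j) (ℚΣ.sum-cong-≗ λ a → ι-* (M i a) (N a j))

*-zero-cancel : ∀ {p q} → p ≢ 0ℚ → p ℚ.* q ≡ 0ℚ → q ≡ 0ℚ
*-zero-cancel {p} {q} p≢0 pq = begin
  q                      ≡⟨ ℚ.*-identityˡ q ⟨
  1ℚ ℚ.* q               ≡⟨ cong (ℚ._* q) (ℚ.*-inverseˡ p) ⟨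
  ℚ.1/ p ℚ.* p ℚ.* q     ≡⟨ ℚ.*-assoc (ℚ.1/ p) p q ⟩
  ℚ.1/ p ℚ.* (p ℚ.* q)   ≡⟨ cong (ℚ.1/ p ℚ.*_) pq ⟩
  ℚ.1/ p ℚ.* 0ℚ          ≡⟨ ℚ.*-zeroʳ (ℚ.1/ p) ⟩
  0ℚ                     ∎
  where instance
    p-nonZero : ℚ.NonZero p
    p-nonZero = ℚ.≢-nonZero p≢0

clear-denominators : {n : ℕ} (f : Vector ℚ n) → ∃₂ λ (N : ℤ) (g : Vector ℤ n) →
                     N ≢ 0ℤ × (∀ i → ι N ℚ.* f i ≡ ι (g i))
clear-denominators {zero}  f = 1ℤ , (λ ()) , (λ ()) , λ ()
clear-denominators {suc n} f with clear-denominators (f ∘ suc)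
... | N , g , N≢0 , eq = ℚ.↧ f zero ℤ.* N , g′ , nonzero , eq′
  where
  d = ℚ.↧ f zero
  nonzero : d ℤ.* N ≢ 0ℤ
  nonzero dN≡0 with ℤ.i*j≡0⇒i≡0∨j≡0 d dN≡0
  ... | inj₁ d≡0 = contradiction d≡0 λ ()
  ... | inj₂ N≡0 = N≢0 N≡0
  g′ : Vector ℤ (suc n)
  g′ zero    = N ℤ.* ℚ.↥ f zero
  g′ (suc i) = d ℤ.* g i
  eq′ : ∀ i → ι (d ℤ.* N) ℚ.* f i ≡ ι (g′ i)
  eq′ zero = begin
    ι (d ℤ.* N) ℚ.* f zero        ≡⟨ cong (λ x → ι x ℚ.* f zero) (ℤ.*-comm d N) ⟩
    ι (N ℤ.* d) ℚ.* f zero        ≡⟨ cong (ℚ._* f zero) (ι-* N d) ⟩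
    ι N ℚ.* ι d ℚ.* f zero        ≡⟨ ℚ.*-assoc (ι N) (ι d) (f zero) ⟩
    ι N ℚ.* (ι d ℚ.* f zero)      ≡⟨ cong (ι N ℚ.*_) (ι-denominator (f zero)) ⟩
    ι N ℚ.* ι (ℚ.↥ f zero)        ≡⟨ ι-* N _ ⟨
    ι (N ℤ.* ℚ.↥ f zero)          ∎
  eq′ (suc i) = begin
    ι (d ℤ.* N) ℚ.* f (suc i)     ≡⟨ cong (ℚ._* f (suc i)) (ι-* d N) ⟩
    ι d ℚ.* ι N ℚ.* f (suc i)     ≡⟨ ℚ.*-assoc (ι d) (ι N) (f (suc i)) ⟩
    ι d ℚ.* (ι N ℚ.* f (suc i))   ≡⟨ cong (ι d ℚ.*_) (eq i) ⟩
    ι d ℚ.* ι (g i)               ≡⟨ ι-* d (g i) ⟨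
    ι (d ℤ.* g i)                 ∎

dot-cong : {m : ℕ} (w : Vector ℚ m) {x y : Vector ℚ m} → (∀ i → x i ≡ y i) →
           ℚΣ.sum (λ i → w i ℚ.* x i) ≡ ℚΣ.sum (λ i → w i ℚ.* y i)
dot-cong w eq = ℚΣ.sum-cong-≗ λ i → cong (w i ℚ.*_) (eq i)

lincomb-assoc : {k m n : ℕ} (w : Vector ℚ k) (K : Matrix ℚ k m) (M : Matrix ℚ m n) → ∀ j →
                lincomb w (λ i → lincomb (K i) M) j ≡ lincomb (lincomb w K) M j
lincomb-assoc w K M j = begin
  ℚΣ.sum (λ i → w i ℚ.* ℚΣ.sum (λ a → K i a ℚ.* M a j))
    ≡⟨ ℚΣ.sum-cong-≗ (λ i → ℚΣ.*-distribˡ-sum (w i) (λ a → K i a ℚ.* M a j)) ⟩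
  ℚΣ.sum (λ i → ℚΣ.sum (λ a → w i ℚ.* (K i a ℚ.* M a j)))
    ≡⟨ ℚΣ.sum-cong-≗ (λ i → ℚΣ.sum-cong-≗ (λ a → ℚ.*-assoc (w i) (K i a) (M a j))) ⟨
  ℚΣ.sum (λ i → ℚΣ.sum (λ a → w i ℚ.* K i a ℚ.* M a j))
    ≡⟨ ℚΣ.∑-comm (λ i a → w i ℚ.* K i a ℚ.* M a j) ⟩
  ℚΣ.sum (λ a → ℚΣ.sum (λ i → w i ℚ.* K i a ℚ.* M a j))
    ≡⟨ ℚΣ.sum-cong-≗ (λ a → ℚΣ.*-distribʳ-sum (M a j) (λ i → w i ℚ.* K i a)) ⟨
  ℚΣ.sum (λ a → ℚΣ.sum (λ i → w i ℚ.* K i a) ℚ.* M a j) ∎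

lincomb-zeroˡ : {m n : ℕ} (w : Vector ℚ m) (V : Matrix ℚ m n) → (∀ i → w i ≡ 0ℚ) →
                ∀ j → lincomb w V j ≡ 0ℚ
lincomb-zeroˡ w V w≡0 j =
  ℚsum-zero _ λ i → trans (cong (ℚ._* V i j) (w≡0 i)) (ℚ.*-zeroˡ (V i j))

ℚsum-isolate : {n : ℕ} (f : Vector ℚ n) (i : Fin n) → (∀ j → j ≢ i → f j ≡ 0ℚ) →
               ℚΣ.sum f ≡ f i
ℚsum-isolate f zero    others =
  trans (cong (f zero ℚ.+_) (ℚsum-zero (f ∘ suc) λ j → others (suc j) λ ())) (ℚ.+-identityʳ (f zero))
ℚsum-isolate f (suc i) others =
  trans (cong₂ ℚ._+_ (others zero λ ())
          (ℚsum-isolate (f ∘ suc) i λ j j≢i → others (suc j) (j≢i ∘ Fin.suc-injective)))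
        (ℚ.+-identityˡ (f (suc i)))

-- The dimension bound behind all rank comparisons. If s > t, a primitive integer w kills the
-- columns of M, hence the rows of V; independence makes w zero, against w · u = 1.
independent-size : {s t n : ℕ} (V : Matrix ℚ s n) → Independent V → (M : Matrix ℚ s t) →
                   (∀ w → (∀ j → lincomb w M j ≡ 0ℚ) → ∀ j → lincomb w V j ≡ 0ℚ) → s ≤ t
independent-size {s} {t} V independent M h with s ℕ.≤? t
... | yes s≤t = s≤t
... | no  s≰t = contradiction (trans (sym wu) (sum-zero _ λ i → trans
    (cong (ℤ._* u i) (ι-injective {w i} {0ℤ} (independent (ι ∘ w) (h (ι ∘ w) wM) i))) (ℤ.*-zeroˡ (u i)))) λ ()
  where
  -- Each column gets its own common denominator; scaling a column by a nonzero number keeps the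
  -- left kernel.
  N : Fin t → ℤ
  N j = proj₁ (clear-denominators (λ i → M i j))
  g : (j : Fin t) → Vector ℤ s
  g j = proj₁ (proj₂ (clear-denominators (λ i → M i j)))
  N≢0 : ∀ j → N j ≢ 0ℤ
  N≢0 j = proj₁ (proj₂ (proj₂ (clear-denominators (λ i → M i j))))
  NM : ∀ j i → ι (N j) ℚ.* M i j ≡ ι (g j i)
  NM j = proj₂ (proj₂ (proj₂ (clear-denominators (λ i → M i j))))
  ker = kernel (ℕ.≰⇒> s≰t) (λ i j → g j i)
  w = proj₁ ker
  u = proj₁ (proj₂ ker)
  wu = proj₁ (proj₂ (proj₂ ker))
  wM : ∀ j → lincomb (ι ∘ w) M j ≡ 0ℚ
  wM j = *-zero-cancel (N≢0 j ∘ ι-injective) (begin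
    ι (N j) ℚ.* lincomb (ι ∘ w) M j
      ≡⟨ ℚΣ.*-distribˡ-sum (ι (N j)) (λ i → ι (w i) ℚ.* M i j) ⟩
    ℚΣ.sum (λ i → ι (N j) ℚ.* (ι (w i) ℚ.* M i j))
      ≡⟨ ℚΣ.sum-cong-≗ (λ i → trans (sym (ℚ.*-assoc (ι (N j)) (ι (w i)) (M i j)))
           (trans (cong (ℚ._* M i j) (ℚ.*-comm (ι (N j)) (ι (w i))))
             (ℚ.*-assoc (ι (w i)) (ι (N j)) (M i j)))) ⟩
    ℚΣ.sum (λ i → ι (w i) ℚ.* (ι (N j) ℚ.* M i j))
      ≡⟨ ℚΣ.sum-cong-≗ (λ i → trans (cong (ι (w i) ℚ.*_) (NM j i)) (sym (ι-* (w i) (g j i)))) ⟩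
    ℚΣ.sum (λ i → ι (w i ℤ.* g j i))
      ≡⟨ ι-sum (λ i → w i ℤ.* g j i) ⟨
    ι (ℤΣ.sum (λ i → w i ℤ.* g j i))
      ≡⟨ cong ι (proj₂ (proj₂ (proj₂ ker)) j) ⟩
    0ℚ ∎)

nth-positive : {ds : List ℕ} → All (0 <_) ds → ∀ {j} → j < length ds → 0 < nth ds (suc j)
nth-positive (p ∷ _)  {zero}  _       = p
nth-positive (_ ∷ ps) {suc j} (s≤s q) = nth-positive ps q

module _ {m n : ℕ} {C : Matrix ℤ m n} (S : SmithForm C) (B : RowSpaceBasis (ιᴹ C)) where
  open SmithForm S
  open RowSpaceBasis B
  open Unimodular P-unimodular using () renaming (inverse to P⁻¹)
  open Unimodular Q-unimodular using () renaming (inverse to Q⁻¹)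

  private
    inj : Fin (length factors) → Fin m
    inj i = inject≤ i length≤rows

    K : Matrix ℚ size m
    K i = proj₁ (inRowSpace i)

    L : Matrix ℚ m size
    L i = proj₁ (spanning i)

  -- C = P⁻¹ D Q⁻¹, and only the first `length factors` rows of D are nonzero, so that many
  -- coordinates of K P⁻¹ determine a combination of the basis vectors.
  size≤length : size ≤ length factors
  size≤length = independent-size vectors independent (λ i b → lincomb (K i) (ιᴹ P⁻¹) (inj b)) h
    where
    h : ∀ w → (∀ b → lincomb w (λ i b → lincomb (K i) (ιᴹ P⁻¹) (inj b)) b ≡ 0ℚ) →
        ∀ j → lincomb w vectors j ≡ 0ℚ
    h w w≡0 j = begin
      lincomb w vectors j
        ≡⟨ dot-cong w (λ i → proj₂ (inRowSpace i) j) ⟩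
      lincomb w (λ i → lincomb (K i) (ιᴹ C)) j
        ≡⟨ lincomb-assoc w K (ιᴹ C) j ⟩
      lincomb wK (ιᴹ C) j
        ≡⟨ dot-cong wK (λ a → trans (cong ι (C-factored S a j)) (ι-· P⁻¹ D a j)) ⟩
      lincomb wK (λ a → lincomb (ιᴹ P⁻¹ a) (ιᴹ D)) j
        ≡⟨ lincomb-assoc wK (ιᴹ P⁻¹) (ιᴹ D) j ⟩
      lincomb (lincomb wK (ιᴹ P⁻¹)) (ιᴹ D) j
        ≡⟨ ℚsum-zero _ vanish ⟩
      0ℚ ∎
      where
      D = diag factors · Q⁻¹
      wK = lincomb w K
      vanish : ∀ b → lincomb wK (ιᴹ P⁻¹) b ℚ.* ι (D b j) ≡ 0ℚ
      vanish b with toℕ b ℕ.<? length factors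
      ... | yes b<len = trans (cong (ℚ._* ι (D b j)) (begin
              lincomb wK (ιᴹ P⁻¹) b
                ≡⟨ lincomb-assoc w K (ιᴹ P⁻¹) b ⟨
              lincomb w (λ i → lincomb (K i) (ιᴹ P⁻¹)) b
                ≡⟨ cong (lincomb w (λ i → lincomb (K i) (ιᴹ P⁻¹))) b≡ ⟩
              lincomb w (λ i → lincomb (K i) (ιᴹ P⁻¹)) (inj (fromℕ< b<len))
                ≡⟨ w≡0 (fromℕ< b<len) ⟩
              0ℚ ∎))
            (ℚ.*-zeroˡ (ι (D b j)))
        where
        b≡ : b ≡ inj (fromℕ< b<len)
        b≡ = Fin.toℕ-injective (sym (trans (Fin.toℕ-inject≤ _ _) (Fin.toℕ-fromℕ< b<len)))
      ... | no b≮len = trans (cong (lincomb wK (ιᴹ P⁻¹) b ℚ.*_) (cong ι (sum-zero _ λ c →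
              trans (cong (ℤ._* Q⁻¹ c j) (diag≡0 c)) (ℤ.*-zeroˡ (Q⁻¹ c j)))))
            (ℚ.*-zeroʳ (lincomb wK (ιᴹ P⁻¹) b))
        where
        diag≡0 : ∀ c → diag factors b c ≡ 0ℤ
        diag≡0 c with toℕ b ℕ.≟ toℕ c
        ... | yes eq = trans (diag-on factors b c eq)
                             (cong +_ (nth-beyond factors (ℕ.≮⇒≥ b≮len)))
        ... | no neq = diag-off factors b c neq

  -- The nonzero rows of D = P C Q are independent, and they are combinations of the basis vectors
  -- multiplied by Q.
  length≤size : length factors ≤ size
  length≤size = independent-size (λ i → ιᴹ (diag factors) (inj i)) diag-independent
    (λ i → lincomb (ιᴹ P (inj i)) L) h
    where
    diag-independent : Independent (λ i → ιᴹ (diag factors) (inj i))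
    diag-independent w w≡0 i = *-zero-cancel (d≢0 ∘ ℤ.+-injective ∘ ι-injective) (begin
      ι d ℚ.* w i                               ≡⟨ ℚ.*-comm (ι d) (w i) ⟩
      w i ℚ.* ι d                               ≡⟨ cong (λ x → w i ℚ.* ι x) on ⟨
      w i ℚ.* ι (diag factors (inj i) c)        ≡⟨ ℚsum-isolate
                                                     (λ i → w i ℚ.* ι (diag factors (inj i) c)) i off ⟨
      lincomb w (λ i → ιᴹ (diag factors) (inj i)) c ≡⟨ w≡0 c ⟩
      0ℚ                                        ∎)
      where
      c = inject≤ i length≤cols
      d = + nth factors (suc (toℕ i))
      d≢0 : nth factors (suc (toℕ i)) ≢ 0
      d≢0 = ℕ.>⇒≢ (nth-positive positive (Fin.toℕ<n i))
      on : diag factors (inj i) c ≡ d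
      on = trans (diag-on factors (inj i) c
                   (trans (Fin.toℕ-inject≤ i _) (sym (Fin.toℕ-inject≤ i _))))
                 (cong (λ x → + nth factors (suc x)) (Fin.toℕ-inject≤ i _))
      off : ∀ j → j ≢ i → w j ℚ.* ι (diag factors (inj j) c) ≡ 0ℚ
      off j j≢i = trans (cong (λ x → w j ℚ.* ι x) (diag-off factors (inj j) c
          λ eq → j≢i (Fin.toℕ-injective (trans (sym (Fin.toℕ-inject≤ j _))
                        (trans eq (Fin.toℕ-inject≤ i _))))))
        (ℚ.*-zeroʳ (w j))
    h : ∀ w → (∀ j → lincomb w (λ i → lincomb (ιᴹ P (inj i)) L) j ≡ 0ℚ) →
        ∀ j → lincomb w (λ i → ιᴹ (diag factors) (inj i)) j ≡ 0ℚ
    h w w≡0 j = begin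
      lincomb w (λ i → ιᴹ (diag factors) (inj i)) j
        ≡⟨ dot-cong w (λ i → trans (cong ι (sym (diagonal (inj i) j))) (ι-· (P · C) Q (inj i) j)) ⟩
      lincomb w (λ i → lincomb (ιᴹ (P · C) (inj i)) (ιᴹ Q)) j
        ≡⟨ lincomb-assoc w (ιᴹ (P · C) ∘ inj) (ιᴹ Q) j ⟩
      lincomb (lincomb w (ιᴹ (P · C) ∘ inj)) (ιᴹ Q) j
        ≡⟨ lincomb-zeroˡ _ (ιᴹ Q) (λ b → begin
             lincomb w (ιᴹ (P · C) ∘ inj) b
               ≡⟨ dot-cong w (λ i → trans (ι-· P C (inj i) b)
                    (trans (dot-cong (ιᴹ P (inj i)) (λ a → proj₂ (spanning a) b))
                           (lincomb-assoc (ιᴹ P (inj i)) L vectors b))) ⟩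
             lincomb w (λ i → lincomb (lincomb (ιᴹ P (inj i)) L) vectors) b
               ≡⟨ lincomb-assoc w (λ i → lincomb (ιᴹ P (inj i)) L) vectors b ⟩
             lincomb (lincomb w (λ i → lincomb (ιᴹ P (inj i)) L)) vectors b
               ≡⟨ lincomb-zeroˡ _ vectors w≡0 b ⟩
             0ℚ ∎) j ⟩
      0ℚ ∎

-- Through this identity `nth` is positive at the index given by the rank and zero at every later
-- one.
rank≡length : {m n : ℕ} (C : Matrix ℤ m n) → rank C ≡ length (invariantFactors C)
rank≡length C = ℕ.≤-antisym (size≤length (smith C) (rowSpaceBasis (ιᴹ C)))
                            (length≤size (smith C) (rowSpaceBasis (ιᴹ C)))

module _ {m n : ℕ} (C : Matrix ℤ m n) (c : Vector ℤ m) where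
  private
    module B = RowSpaceBasis (rowSpaceBasis (ιᴹ C))
    module B̄ = RowSpaceBasis (rowSpaceBasis (ιᴹ (augment C c)))

  rank≤rank-augment : rank C ≤ rank (augment C c)
  rank≤rank-augment = independent-size B.vectors B.independent (λ i → lincomb (K i) L) h
    where
    K : Matrix ℚ B.size m
    K i = proj₁ (B.inRowSpace i)
    L : Matrix ℚ m B̄.size
    L i = proj₁ (B̄.spanning i)
    h : ∀ w → (∀ j → lincomb w (λ i → lincomb (K i) L) j ≡ 0ℚ) → ∀ j → lincomb w B.vectors j ≡ 0ℚ
    h w w≡0 j = begin
      lincomb w B.vectors j
        ≡⟨ dot-cong w (λ i → proj₂ (B.inRowSpace i) j) ⟩
      lincomb w (λ i → lincomb (K i) (ιᴹ C)) j
        ≡⟨ lincomb-assoc w K (ιᴹ C) j ⟩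
      lincomb (lincomb w K) (ιᴹ C) j
        ≡⟨ ℚΣ.sum-cong-≗ (λ a → cong (lincomb w K a ℚ.*_)
             (trans (cong ι (sym (augment-left C c a j))) (proj₂ (B̄.spanning a) (j ↑ˡ 1)))) ⟩
      lincomb (lincomb w K) (λ a → lincomb (L a) B̄.vectors) (j ↑ˡ 1)
        ≡⟨ lincomb-assoc (lincomb w K) L B̄.vectors (j ↑ˡ 1) ⟩
      lincomb (lincomb (lincomb w K) L) B̄.vectors (j ↑ˡ 1)
        ≡⟨ lincomb-zeroˡ _ B̄.vectors (λ b → trans (sym (lincomb-assoc w K L b)) (w≡0 b)) (j ↑ˡ 1) ⟩
      0ℚ ∎

  -- Together with `rank≤rank-augment` this leaves only r̄ = r and r̄ = r + 1, so a J outside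
  -- `consistent` lies in `inconsistent` and is taken into account by q₀.
  rank-augment≤1+rank : rank (augment C c) ≤ suc (rank C)
  rank-augment≤1+rank = independent-size B̄.vectors B̄.independent M h
    where
    K : Matrix ℚ B̄.size m
    K i = proj₁ (B̄.inRowSpace i)
    L : Matrix ℚ m B.size
    L i = proj₁ (B.spanning i)
    -- The extra column holds the last coordinate, the one that a basis of the row space of C does
    -- not control.
    M : Matrix ℚ B̄.size (suc B.size)
    M i zero    = B̄.vectors i (n ↑ʳ zero)
    M i (suc j) = lincomb (K i) L j
    h : ∀ w → (∀ j → lincomb w M j ≡ 0ℚ) → ∀ j → lincomb w B̄.vectors j ≡ 0ℚ
    h w w≡0 j = subst (λ j → lincomb w B̄.vectors j ≡ 0ℚ) (Fin.join-splitAt n 1 j)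
      (column (Fin.splitAt n j))
      where
      column : ∀ j → lincomb w B̄.vectors (Fin.join n 1 j) ≡ 0ℚ
      column (inj₂ zero) = w≡0 zero
      column (inj₁ j) = begin
        lincomb w B̄.vectors (j ↑ˡ 1)
          ≡⟨ dot-cong w (λ i → proj₂ (B̄.inRowSpace i) (j ↑ˡ 1)) ⟩
        lincomb w (λ i → lincomb (K i) (ιᴹ (augment C c))) (j ↑ˡ 1)
          ≡⟨ lincomb-assoc w K (ιᴹ (augment C c)) (j ↑ˡ 1) ⟩
        lincomb (lincomb w K) (ιᴹ (augment C c)) (j ↑ˡ 1)
          ≡⟨ ℚΣ.sum-cong-≗ (λ a → cong (lincomb w K a ℚ.*_)
               (trans (cong ι (augment-left C c a j)) (proj₂ (B.spanning a) j))) ⟩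
        lincomb (lincomb w K) (λ a → lincomb (L a) B.vectors) j
          ≡⟨ lincomb-assoc (lincomb w K) L B.vectors j ⟩
        lincomb (lincomb (lincomb w K) L) B.vectors j
          ≡⟨ lincomb-zeroˡ _ B.vectors
               (λ b → trans (sym (lincomb-assoc w K L b)) (w≡0 (suc b))) j ⟩
        0ℚ ∎

-- Congruences

-- Unlike _≅_[mod_], a record determines the two sides of a congruence for inference.
record Congruent (q : ℕ) (x y : ℤ) : Set where
  constructor congruent
  field divides-difference : x ≅ y [mod q ]
open Congruent

module _ {q : ℕ} where
  infix 4 _≈_
  _≈_ : ℤ → ℤ → Set
  _≈_ = Congruent q

  ≈-reflexive : ∀ {x y} → x ≡ y → x ≈ y
  ≈-reflexive {x} refl = congruent (∣-≡ (sym (ℤ.+-inverseʳ x)) ∣0)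

  ≈-sym : ∀ {x y} → x ≈ y → y ≈ x
  ≈-sym {x} {y} (congruent p) =
    congruent (∣-≡ (solve 2 (λ x y → :- (x :- y) := y :- x) refl x y) (∣m⇒∣-m p))

  ≈-trans : ∀ {x y z} → x ≈ y → y ≈ z → x ≈ z
  ≈-trans {x} {y} {z} (congruent p) (congruent r) =
    congruent (∣-≡ (solve 3 (λ x y z → (x :- y) :+ (y :- z) := x :- z) refl x y z) (∣m∣n⇒∣m+n p r))

  ≈-+ : ∀ {x y z t} → x ≈ y → z ≈ t → x ℤ.+ z ≈ y ℤ.+ t
  ≈-+ {x} {y} {z} {t} (congruent p) (congruent r) = congruent
    (∣-≡ (solve 4 (λ x y z t → (x :- y) :+ (z :- t) := (x :+ z) :- (y :+ t)) refl x y z t)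
      (∣m∣n⇒∣m+n p r))

  ≈-*ˡ : ∀ {x y} k → x ≈ y → k ℤ.* x ≈ k ℤ.* y
  ≈-*ˡ {x} {y} k (congruent p) = congruent (*-∣-difference {x = x} {y} k p)

  ≈-⊙ : {m n : ℕ} (M : Matrix ℤ m n) {v w : Vector ℤ n} → (∀ j → v j ≈ w j) →
        ∀ i → (M ⊙ v) i ≈ (M ⊙ w) i
  ≈-⊙ {m} M {v} {w} p i = sums _ _ λ j → ≈-*ˡ (M i j) (p j)
    where
    sums : {n : ℕ} (f g : Vector ℤ n) → (∀ i → f i ≈ g i) → ℤΣ.sum f ≈ ℤΣ.sum g
    sums {zero}  f g p = ≈-reflexive refl
    sums {suc n} f g p = ≈-+ (p zero) (sums (f ∘ suc) (g ∘ suc) (p ∘ suc))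

  collapse : ∀ {a b} → b < q → a ≤ b → + b ≈ + a → b ≡ a
  collapse {a} {b} b<q a≤b (congruent p) with b ℕ.∸ a in eq
  ... | zero  = ℕ.≤-antisym (ℕ.m∸n≡0⇒m≤n eq) a≤b
  ... | suc k = contradiction (subst (q ℕ∣.∣_) size (∣⇒∣ᵤ p))
                  (ℕ∣.>⇒∤ (ℕ.≤-<-trans (subst (_≤ b) eq (ℕ.m∸n≤m b a)) b<q))
    where
    size : ℤ.∣ + b ℤ.- + a ∣ ≡ suc k
    size = trans (cong ℤ.∣_∣ (ℤ.m-n≡m⊖n b a))
           (trans (ℤ.∣m⊖n∣≡∣n⊖m∣ b a) (trans (ℤ.∣⊖∣-≤ a≤b) eq))
  ≈-small : ∀ {a b} → a < q → b < q → + a ≈ + b → a ≡ b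
  ≈-small {a} {b} a<q b<q a≈b with ℕ.≤-total a b
  ... | inj₁ a≤b = sym (collapse b<q a≤b (≈-sym a≈b))
  ... | inj₂ b≤a = collapse a<q b≤a a≈b

≈-weaken : ∀ {e q x y} → e ℕ∣.∣ q → Congruent q x y → Congruent e x y
≈-weaken e∣q (congruent p) = congruent (∣-trans (∣ᵤ⇒∣ e∣q) p)

%-≈ : ∀ x q .{{_ : ℕ.NonZero q}} → Congruent q (+ (x ℤ.%ℕ q)) x
%-≈ x q = ≈-sym (congruent (divides (x ℤ./ℕ q)
  (trans (cong (ℤ._- r) (ℤ.a≡a%ℕn+[a/ℕn]*n x q))
    (solve 2 (λ r t → (r :+ t) :- r := t) refl r (x ℤ./ℕ q ℤ.* + q)))))
  where r = + (x ℤ.%ℕ q)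

column : {n : ℕ} → Vector ℤ n → Matrix ℤ n 1
column v i _ = v i

⊙-assoc : {k m n : ℕ} (M : Matrix ℤ k m) (N : Matrix ℤ m n) (v : Vector ℤ n) →
          ∀ i → (M · N ⊙ v) i ≡ (M ⊙ (N ⊙ v)) i
⊙-assoc M N v i = ·-assoc M N (column v) i zero

≐-⊙ : {m n : ℕ} {M N : Matrix ℤ m n} → M ≐ N → (v : Vector ℤ n) → ∀ i → (M ⊙ v) i ≡ (N ⊙ v) i
≐-⊙ p v i = ·-congʳ (column v) p i zero

Id-⊙ : {n : ℕ} (v : Vector ℤ n) → ∀ i → (Id ⊙ v) i ≡ v i
Id-⊙ v i = ·-identityˡ (column v) i zero

inverse-⊙ : {n : ℕ} (P R : Matrix ℤ n n) → P · R ≐ Id → (v : Vector ℤ n) →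
            ∀ i → (P ⊙ (R ⊙ v)) i ≡ v i
inverse-⊙ P R PR v i = trans (sym (⊙-assoc P R v i)) (trans (≐-⊙ PR v i) (Id-⊙ v i))

unimodular-cancel : {q n : ℕ} {P : Matrix ℤ n n} → Unimodular P → (v w : Vector ℤ n) →
                    (∀ i → Congruent q ((P ⊙ v) i) ((P ⊙ w) i)) → ∀ i → Congruent q (v i) (w i)
unimodular-cancel {P = P} U v w p i =
  ≈-trans (≈-reflexive (sym (inverse-⊙ inverse P inverseˡ v i)))
    (≈-trans (≈-⊙ inverse p i) (≈-reflexive (inverse-⊙ inverse P inverseˡ w i)))
  where open Unimodular U

-- Counting by explicit enumeration

-- Cardinalities are compared through membership: duplicate-free lists with the same members are
-- permutations of each other.
length-≡ : {X : Set} {xs ys : List X} → Unique xs → Unique ys →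
           (∀ {z} → z ∈ xs → z ∈ ys) → (∀ {z} → z ∈ ys → z ∈ xs) → length xs ≡ length ys
length-≡ xs! ys! to from = ↭-length (∼bag⇒↭ (unique∧set⇒bag xs! ys! (mk⇔ to from)))

length-cartesianProductWith : {X Y Z : Set} (f : X → Y → Z) (xs : List X) (ys : List Y) →
                              length (cartesianProductWith f xs ys) ≡ length xs ℕ.* length ys
length-cartesianProductWith f []       ys = refl
length-cartesianProductWith f (x ∷ xs) ys = trans (List.length-++ (map (f x) ys))
  (cong₂ ℕ._+_ (List.length-map (f x) ys) (length-cartesianProductWith f xs ys))

points : (q n : ℕ) → List (Point q n)
points q n = allVectors (allFin q) n

∈-points : {q n : ℕ} (x : Point q n) → x ∈ points q n
∈-points Vec.[]       = here refl
∈-points (y Vec.∷ ys) = ∈-cartesianProductWith⁺ Vec._∷_ (∈-allFin y) (∈-points ys)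

points-unique : (q n : ℕ) → Unique (points q n)
points-unique q zero    = [] ∷ []
points-unique q (suc n) =
  Unique.cartesianProductWith⁺ Vec._∷_ Vec.∷-injective (Unique.allFin⁺ q) (points-unique q n)

length-points : (q n : ℕ) → length (points q n) ≡ q ℕ.^ n
length-points q zero    = refl
length-points q (suc n) = trans (length-cartesianProductWith Vec._∷_ (allFin q) (points q n))
  (cong₂ ℕ._*_ (List.length-tabulate {n = q} (λ i → i)) (length-points q n))

values : {q n : ℕ} → Point q n → Vector ℤ n
values x j = + toℕ (Vec.lookup x j)

values-injective : {q n : ℕ} {x y : Point q n} →
                   (∀ j → Congruent q (values x j) (values y j)) → x ≡ y
values-injective {x = x} {y} p = begin
  x                          ≡⟨ Vec.tabulate∘lookup x ⟨
  Vec.tabulate (Vec.lookup x) ≡⟨ Vec.tabulate-cong (λ j →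
                                  Fin.toℕ-injective (≈-small (Fin.toℕ<n _) (Fin.toℕ<n _) (p j))) ⟩
  Vec.tabulate (Vec.lookup y) ≡⟨ Vec.tabulate∘lookup y ⟩
  y                          ∎

module _ {q : ℕ} .{{_ : ℕ.NonZero q}} where

  point : {n : ℕ} → Vector ℤ n → Point q n
  point v = Vec.tabulate λ j → fromℕ< (ℤ.n%ℕd<d (v j) q)

  values-point : {n : ℕ} (v : Vector ℤ n) → ∀ j → Congruent q (values (point v) j) (v j)
  values-point v j = ≈-trans
    (≈-reflexive (cong +_ (trans (cong toℕ (Vec.lookup∘tabulate _ j)) (Fin.toℕ-fromℕ< _))))
    (%-≈ (v j) q)

Solves : {m n : ℕ} → Matrix ℤ m n → Vector ℤ m → (q : ℕ) → Point q n → Set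
Solves C c q x = ∀ i → C i • x ≅ c i [mod q ]

solves? : {m n : ℕ} (C : Matrix ℤ m n) (c : Vector ℤ m) (q : ℕ) → Decidable (Solves C c q)
solves? C c q x = Fin.all? λ i → (C i • x) ≅? c i [mod q ]

#solutions : {m n : ℕ} → Matrix ℤ m n → Vector ℤ m → ℕ → ℕ
#solutions {n = n} C c q = length (filter (solves? C c q) (points q n))

module _ {m n : ℕ} {C : Matrix ℤ m n} (S : SmithForm C) (c : Vector ℤ m)
         {q : ℕ} .{{_ : ℕ.NonZero q}} where
  open SmithForm S
  open Unimodular Q-unimodular using () renaming (inverse to Q⁻¹; inverseʳ to QQ⁻¹)

  private
    D : Matrix ℤ m n
    D = diag factors

    D-⊙ : (x y : Point q n) → (∀ j → Congruent q (values x j) ((Q ⊙ values y) j)) →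
          ∀ i → Congruent q ((P ⊙ (C ⊙ values x)) i) ((D ⊙ values y) i)
    D-⊙ x y x≈Qy i = ≈-trans (≈-⊙ P (≈-⊙ C x≈Qy) i) (≈-reflexive (begin
      (P ⊙ (C ⊙ (Q ⊙ values y))) i   ≡⟨ ⊙-assoc P C (Q ⊙ values y) i ⟨
      (P · C ⊙ (Q ⊙ values y)) i     ≡⟨ ⊙-assoc (P · C) Q (values y) i ⟨
      (P · C · Q ⊙ values y) i       ≡⟨ ≐-⊙ diagonal (values y) i ⟩
      (D ⊙ values y) i               ∎))

    substitute : Point q n → Point q n
    substitute y = point (Q ⊙ values y)

    substitute-injective : ∀ {x y} → substitute x ≡ substitute y → x ≡ y
    substitute-injective {x} {y} eq = values-injective
      (unimodular-cancel Q-unimodular (values x) (values y) λ j →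
        ≈-trans (≈-sym (values-point (Q ⊙ values x) j))
          (≈-trans (≈-reflexive (cong (λ z → values z j) eq)) (values-point (Q ⊙ values y) j)))

    from-diagonal : ∀ y → Solves D (P ⊙ c) q y → Solves C c q (substitute y)
    from-diagonal y sol i = divides-difference
      (unimodular-cancel P-unimodular (C ⊙ values (substitute y)) c
        (λ i → ≈-trans (D-⊙ (substitute y) y (values-point (Q ⊙ values y)) i)
          (congruent (sol i))) i)

    to-diagonal : ∀ x → Solves C c q x → ∃ λ y → Solves D (P ⊙ c) q y × x ≡ substitute y
    to-diagonal x sol = y
      , (λ i → divides-difference (≈-trans (≈-sym (D-⊙ x y x≈Qy i)) (≈-⊙ P (congruent ∘ sol) i)))
      , values-injective (λ j → ≈-trans (x≈Qy j) (≈-sym (values-point (Q ⊙ values y) j)))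
      where
      y : Point q n
      y = point (Q⁻¹ ⊙ values x)
      x≈Qy : ∀ j → Congruent q (values x j) ((Q ⊙ values y) j)
      x≈Qy j = ≈-sym (≈-trans (≈-⊙ Q (values-point (Q⁻¹ ⊙ values x)) j)
                              (≈-reflexive (inverse-⊙ Q Q⁻¹ QQ⁻¹ (values x) j)))

  private
    solutions : List (Point q n)
    solutions = filter (solves? C c q) (points q n)

    diagonal-solutions : List (Point q n)
    diagonal-solutions = filter (solves? D (P ⊙ c) q) (points q n)

    to : ∀ {x} → x ∈ solutions → x ∈ map substitute diagonal-solutions
    to {x} x∈ = subst (_∈ map substitute diagonal-solutions) (sym (proj₂ (proj₂ y)))
      (∈-map⁺ substitute (∈-filter⁺ (solves? D (P ⊙ c) q) (∈-points (proj₁ y)) (proj₁ (proj₂ y))))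
      where y = to-diagonal x (proj₂ (∈-filter⁻ (solves? C c q) {xs = points q n} x∈))

    from : ∀ {x} → x ∈ map substitute diagonal-solutions → x ∈ solutions
    from {x} x∈ = subst (_∈ solutions) (sym (proj₂ (proj₂ y)))
      (∈-filter⁺ (solves? C c q) (∈-points (substitute (proj₁ y)))
        (from-diagonal (proj₁ y) (proj₂ (∈-filter⁻ (solves? D (P ⊙ c) q) {xs = points q n}
          (proj₁ (proj₂ y))))))
      where y = ∈-map⁻ substitute x∈

  -- Modulo q the substitution x = Q y permutes the points, and multiplying the equations by P is
  -- reversible; together they turn C into P C Q.
  #solutions-diagonal : #solutions C c q ≡ #solutions {n = n} (diag factors) (P ⊙ c) q
  #solutions-diagonal = trans
    (length-≡ {xs = solutions} {ys = map substitute diagonal-solutions}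
      (Unique.filter⁺ (solves? C c q) (points-unique q n))
      (Unique.map⁺ {f = substitute} substitute-injective
        (Unique.filter⁺ (solves? D (P ⊙ c) q) (points-unique q n)))
      to from)
    (List.length-map substitute diagonal-solutions)

-- Linear congruences in one variable

bezout : (d q : ℕ) → ∃ λ u → Congruent q (+ d ℤ.* u) (+ gcd d q)
bezout d q with Bézout.identity (gcd-GCD d q)
... | +- x y eq = + x , congruent (divides (+ y) (begin
  + d ℤ.* + x ℤ.- + gcd d q                       ≡⟨ cong (ℤ._- + gcd d q) (trans (sym (ℤ.pos-* d x))
                                                       (cong +_ (trans (ℕ.*-comm d x) (sym eq)))) ⟩
  + (gcd d q ℕ.+ y ℕ.* q) ℤ.- + gcd d q           ≡⟨ cong (ℤ._- + gcd d q) (trans (ℤ.pos-+ (gcd d q) (y ℕ.* q))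
                                                       (cong (λ z → + gcd d q ℤ.+ z) (ℤ.pos-* y q))) ⟩
  + gcd d q ℤ.+ + y ℤ.* + q ℤ.- + gcd d q         ≡⟨ solve 2 (λ g z → (g :+ z) :- g := z) refl
                                                       (+ gcd d q) (+ y ℤ.* + q) ⟩
  + y ℤ.* + q                                     ∎))
... | -+ x y eq = ℤ.- (+ x) , congruent (divides (ℤ.- (+ y)) (begin
  + d ℤ.* (ℤ.- (+ x)) ℤ.- + gcd d q               ≡⟨ solve 3 (λ d x g → d :* (:- x) :- g := :- (g :+ x :* d))
                                                       refl (+ d) (+ x) (+ gcd d q) ⟩
  ℤ.- (+ gcd d q ℤ.+ + x ℤ.* + d)                 ≡⟨ cong ℤ.-_ (trans (cong (λ z → + gcd d q ℤ.+ z) (sym (ℤ.pos-* x d)))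
                                                       (trans (sym (ℤ.pos-+ (gcd d q) (x ℕ.* d))) (cong +_ eq))) ⟩
  ℤ.- (+ (y ℕ.* q))                               ≡⟨ cong ℤ.-_ (ℤ.pos-* y q) ⟩
  ℤ.- (+ y ℤ.* + q)                               ≡⟨ ℤ.neg-distribˡ-* (+ y) (+ q) ⟩
  ℤ.- (+ y) ℤ.* + q                               ∎))

module _ (d : ℕ) (c : ℤ) (q : ℕ) .{{_ : ℕ.NonZero q}} (g∣c : + gcd d q ∣ c) where
  private
    g = gcd d q

    instance
      g-nonZero : ℕ.NonZero g
      g-nonZero = ℕ.≢-nonZero λ g≡0 → ℕ.≢-nonZero⁻¹ q (gcd[m,n]≡0⇒n≡0 d g≡0)

    q′ d′ : ℕ
    q′ = ℕ∣.quotient (gcd[m,n]∣n d q)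
    d′ = ℕ∣.quotient (gcd[m,n]∣m d q)

    q≡q′g : q ≡ q′ ℕ.* g
    q≡q′g = ℕ∣.m∣n⇒n≡quotient*m (gcd[m,n]∣n d q)

    d≡d′g : d ≡ d′ ℕ.* g
    d≡d′g = ℕ∣.m∣n⇒n≡quotient*m (gcd[m,n]∣m d q)

    instance
      q′-nonZero : ℕ.NonZero q′
      q′-nonZero = ℕ.≢-nonZero λ q′≡0 →
        ℕ.≢-nonZero⁻¹ q (trans q≡q′g (cong (ℕ._* g) q′≡0))

    u : ℤ
    u = proj₁ (bezout d q)

    open _∣_ g∣c using () renaming (quotient to k; equality to c≡kg)

    -- From c = k g and d u ≡ g modulo q, the integer k u is a solution; its residue modulo q′ is
    -- the least nonnegative one.
    s : ℕ
    s = k ℤ.* u ℤ.%ℕ q′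

    scale : ∀ {x y} → Congruent q′ x y → Congruent q (+ d ℤ.* x) (+ d ℤ.* y)
    scale {x} {y} (congruent (divides t eq)) = congruent (divides (t ℤ.* + d′) (begin
      + d ℤ.* x ℤ.- + d ℤ.* y             ≡⟨ solve 3 (λ d x y → d :* x :- d :* y := (x :- y) :* d)
                                                refl (+ d) x y ⟩
      (x ℤ.- y) ℤ.* + d                   ≡⟨ cong₂ ℤ._*_ eq (trans (cong +_ d≡d′g) (ℤ.pos-* d′ g)) ⟩
      t ℤ.* + q′ ℤ.* (+ d′ ℤ.* + g)       ≡⟨ solve 4 (λ t q′ d′ g → t :* q′ :* (d′ :* g) := t :* d′ :* (q′ :* g))
                                                refl t (+ q′) (+ d′) (+ g) ⟩
      t ℤ.* + d′ ℤ.* (+ q′ ℤ.* + g)       ≡⟨ cong (t ℤ.* + d′ ℤ.*_)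
                                              (trans (sym (ℤ.pos-* q′ g)) (cong +_ (sym q≡q′g))) ⟩
      t ℤ.* + d′ ℤ.* + q                  ∎))

    -- Multiplying by u turns d x into g x modulo q, and g then cancels against q = q′ g. In this
    -- way u stands in for an inverse of d′ modulo q′.
    unscale : ∀ {x y} → Congruent q (+ d ℤ.* x) (+ d ℤ.* y) → Congruent q′ x y
    unscale {x} {y} p = congruent (*-cancelˡ-∣ (+ g) (∣-≡
      (solve 3 (λ g x y → x :* g :- y :* g := g :* (x :- y)) refl (+ g) x y)
      (subst (_∣ x ℤ.* + g ℤ.- y ℤ.* + g) (trans (cong +_ (trans q≡q′g (ℕ.*-comm q′ g))) (ℤ.pos-* g q′))
        (divides-difference (≈-trans (≈-sym (gx x)) (≈-trans (≈-*ˡ u p) (gx y)))))))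
      where
      gx : ∀ x → Congruent q (u ℤ.* (+ d ℤ.* x)) (x ℤ.* + g)
      gx x = ≈-trans
        (≈-reflexive (solve 3 (λ u d x → u :* (d :* x) := x :* (d :* u)) refl u (+ d) x))
        (≈-*ˡ x (proj₂ (bezout d q)))

    ds≈c : Congruent q (+ d ℤ.* + s) c
    ds≈c = ≈-trans (scale (%-≈ (k ℤ.* u) q′)) (≈-trans
      (≈-reflexive (solve 3 (λ d k u → d :* (k :* u) := k :* (d :* u)) refl (+ d) k u))
      (≈-trans (≈-*ˡ k (proj₂ (bezout d q))) (≈-reflexive (sym c≡kg))))

    s<q′ : s < q′
    s<q′ = ℤ.n%ℕd<d (k ℤ.* u) q′

    bound : (t : Fin g) → s ℕ.+ toℕ t ℕ.* q′ < q
    bound t = ℕ.<-≤-trans (ℕ.+-monoˡ-< (toℕ t ℕ.* q′) s<q′)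
      (subst (suc (toℕ t) ℕ.* q′ ≤_) (trans (ℕ.*-comm g q′) (sym q≡q′g))
        (ℕ.*-monoˡ-≤ q′ (Fin.toℕ<n t)))

    progression : Fin g → Fin q
    progression t = fromℕ< (bound t)

    toℕ-progression : ∀ t → toℕ (progression t) ≡ s ℕ.+ toℕ t ℕ.* q′
    toℕ-progression t = Fin.toℕ-fromℕ< (bound t)

    progression-injective : ∀ {t t′} → progression t ≡ progression t′ → t ≡ t′
    progression-injective {t} {t′} eq = Fin.toℕ-injective (ℕ.*-cancelʳ-≡ _ _ q′
      (ℕ.+-cancelˡ-≡ s _ _ (trans (sym (toℕ-progression t)) (trans (cong toℕ eq) (toℕ-progression t′)))))

    ∈-progression : ∀ y → Congruent q (+ d ℤ.* + toℕ y) c → ∃ λ t → y ≡ progression t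
    ∈-progression y dy≈c = t , Fin.toℕ-injective (begin
      toℕ y                               ≡⟨ ℕ.m≡m%n+[m/n]*n (toℕ y) q′ ⟩
      toℕ y ℕ.% q′ ℕ.+ toℕ y ℕ./ q′ ℕ.* q′ ≡⟨ cong₂ (λ a b → a ℕ.+ b ℕ.* q′) remainder
                                               (sym (Fin.toℕ-fromℕ< y/q′<g)) ⟩
      s ℕ.+ toℕ t ℕ.* q′                   ≡⟨ toℕ-progression t ⟨
      toℕ (progression t)                 ∎)
      where
      y/q′<g : toℕ y ℕ./ q′ < g
      y/q′<g = ℕ.m<n*o⇒m/o<n (subst (toℕ y <_) (trans q≡q′g (ℕ.*-comm q′ g)) (Fin.toℕ<n y))
      t : Fin g
      t = fromℕ< y/q′<g
      remainder : toℕ y ℕ.% q′ ≡ s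
      remainder = ≈-small (ℕ.m%n<n (toℕ y) q′) s<q′
        (≈-trans (%-≈ (+ toℕ y) q′) (unscale (≈-trans dy≈c (≈-sym ds≈c))))

    progression-solves : ∀ t → Congruent q (+ d ℤ.* + toℕ (progression t)) c
    progression-solves t = ≈-trans (scale (congruent (divides (+ toℕ t) (begin
      + toℕ (progression t) ℤ.- + s         ≡⟨ cong (λ z → + z ℤ.- + s) (toℕ-progression t) ⟩
      + (s ℕ.+ toℕ t ℕ.* q′) ℤ.- + s        ≡⟨ cong (ℤ._- + s) (trans (ℤ.pos-+ s (toℕ t ℕ.* q′))
                                                (cong (λ z → + s ℤ.+ z) (ℤ.pos-* (toℕ t) q′))) ⟩
      + s ℤ.+ + toℕ t ℤ.* + q′ ℤ.- + s      ≡⟨ solve 2 (λ s z → (s :+ z) :- s := z) refl (+ s) (+ toℕ t ℤ.* + q′) ⟩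
      + toℕ t ℤ.* + q′                      ∎)))) ds≈c

  linear? : Decidable (λ (y : Fin q) → + d ℤ.* + toℕ y ≅ c [mod q ])
  linear? y = (+ d ℤ.* + toℕ y) ≅? c [mod q ]

  -- The solutions form a single residue class modulo q′, whose members in {0, ..., q - 1} are s + t
  -- q′ with t < g.
  #linear : length (filter linear? (allFin q)) ≡ gcd d q
  #linear = trans
    (length-≡ {xs = filter linear? (allFin q)} {ys = map progression (allFin g)}
      (Unique.filter⁺ linear? (Unique.allFin⁺ q))
      (Unique.map⁺ {f = progression} progression-injective (Unique.allFin⁺ g))
      to from)
    (trans (List.length-map progression (allFin g)) (List.length-tabulate {n = g} (λ i → i)))
    where
    to : ∀ {y} → y ∈ filter linear? (allFin q) → y ∈ map progression (allFin g)
    to {y} y∈ = subst (_∈ map progression (allFin g)) (sym (proj₂ t))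
      (∈-map⁺ progression (∈-allFin (proj₁ t)))
      where t = ∈-progression y (congruent (proj₂ (∈-filter⁻ linear? {xs = allFin q} y∈)))
    from : ∀ {y} → y ∈ map progression (allFin g) → y ∈ filter linear? (allFin q)
    from y∈ = subst (_∈ filter linear? (allFin q)) (sym (proj₂ (proj₂ t)))
      (∈-filter⁺ linear? (∈-allFin (progression (proj₁ t))) (divides-difference (progression-solves (proj₁ t))))
      where t = ∈-map⁻ progression y∈

-- Solution counts

map-range : {X : Set} (f : ℕ → X) (ds : List ℕ) → map (f ∘ nth ds) (range (length ds)) ≡ map f ds
map-range f ds = begin
  map (f ∘ nth ds) (map suc (List.upTo (length ds)))   ≡⟨ List.map-∘ (List.upTo (length ds)) ⟨
  map (f ∘ nth ds ∘ suc) (List.upTo (length ds))       ≡⟨ List.map-upTo (f ∘ nth ds ∘ suc) (length ds) ⟩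
  List.applyUpTo (f ∘ nth ds ∘ suc) (length ds)        ≡⟨ entries ds ⟩
  map f ds                                             ∎
  where
  entries : ∀ ds → List.applyUpTo (f ∘ nth ds ∘ suc) (length ds) ≡ map f ds
  entries []       = refl
  entries (d ∷ ds) = cong (f d ∷_) (entries ds)

module _ {q : ℕ} .{{_ : ℕ.NonZero q}} where

  -- The variables separate: the one multiplied by d has gcd(d, q) admissible values, and each
  -- variable beyond the factors is free.
  #solutions-diag : {m n : ℕ} (ds : List ℕ) → length ds ≤ m → length ds ≤ n → (c : Vector ℤ m) →
                    (∀ i → + gcd q (nth ds (suc (toℕ i))) ∣ c i) →
                    #solutions {n = n} (diag ds) c q ≡
                    product (map (λ d → gcd d q) ds) ℕ.* q ℕ.^ (n ℕ.∸ length ds)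
  #solutions-diag {m} {n} [] _ _ c g∣c = begin
    #solutions {n = n} (diag []) c q    ≡⟨ cong length (List.filter-all (solves? (diag []) c q)
                                             {xs = points q n} (All.universal solved (points q n))) ⟩
    length (points q n)                 ≡⟨ length-points q n ⟩
    q ℕ.^ n                             ≡⟨ ℕ.*-identityˡ (q ℕ.^ n) ⟨
    1 ℕ.* q ℕ.^ n                       ∎
    where
    -- Here the factor is zero and gcd(q, 0) = q, so the hypothesis says q ∣ c i, which is what the
    -- equation 0 ≡ c i demands.
    solved : ∀ x → Solves (diag []) c q x
    solved x i = divides-difference (≈-trans (≈-reflexive (sum-zero _ λ j → ℤ.*-zeroˡ (values x j)))
      (≈-sym (congruent (∣-≡ (sym (ℤ.+-identityʳ (c i)))
        (subst (λ g → + g ∣ c i) (gcd-identityʳ q) (g∣c i))))))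
  #solutions-diag {suc m} {suc n} (d ∷ ds) (s≤s p) (s≤s r) c g∣c = begin
    length solutions
      ≡⟨ length-≡ {xs = solutions} {ys = cartesianProductWith Vec._∷_ heads tails}
           (Unique.filter⁺ (solves? (diag (d ∷ ds)) c q) (points-unique q (suc n)))
           (Unique.cartesianProductWith⁺ Vec._∷_ Vec.∷-injective
             (Unique.filter⁺ head? (Unique.allFin⁺ q)) (Unique.filter⁺ tail? (points-unique q n)))
           to from ⟩
    length (cartesianProductWith Vec._∷_ heads tails)
      ≡⟨ length-cartesianProductWith Vec._∷_ heads tails ⟩
    length heads ℕ.* length tails
      ≡⟨ cong₂ ℕ._*_ (#linear d (c zero) q g∣c₀)
           (#solutions-diag ds p r (c ∘ suc) (g∣c ∘ suc)) ⟩
    gcd d q ℕ.* (product (map (λ d → gcd d q) ds) ℕ.* q ℕ.^ (n ℕ.∸ length ds))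
      ≡⟨ ℕ.*-assoc (gcd d q) _ _ ⟨
    product (map (λ d → gcd d q) (d ∷ ds)) ℕ.* q ℕ.^ (n ℕ.∸ length ds) ∎
    where
    g∣c₀ : + gcd d q ∣ c zero
    g∣c₀ = subst (λ g → + g ∣ c zero) (gcd-comm q d) (g∣c zero)

    head? = linear? d (c zero) q g∣c₀
    tail? = solves? (diag {m} {n} ds) (c ∘ suc) q

    solutions : List (Point q (suc n))
    solutions = filter (solves? (diag (d ∷ ds)) c q) (points q (suc n))
    heads : List (Fin q)
    heads = filter head? (allFin q)
    tails : List (Point q n)
    tails = filter tail? (points q n)

    first-row : ∀ y (ys : Point q n) → diag {suc m} (d ∷ ds) zero • (y Vec.∷ ys) ≡ + d ℤ.* + toℕ y
    first-row y ys = trans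
      (cong (λ z → + d ℤ.* + toℕ y ℤ.+ z) (sum-zero _ λ j → ℤ.*-zeroˡ (values ys j)))
      (ℤ.+-identityʳ (+ d ℤ.* + toℕ y))
    other-row : ∀ i y (ys : Point q n) →
                diag (d ∷ ds) (suc i) • (y Vec.∷ ys) ≡ diag {m} ds i • ys
    other-row i y ys = trans
      (cong (ℤ._+ diag {m} ds i • ys) (ℤ.*-zeroˡ (+ toℕ y))) (ℤ.+-identityˡ (diag {m} ds i • ys))

    to : ∀ {x} → x ∈ solutions → x ∈ cartesianProductWith Vec._∷_ heads tails
    to {y Vec.∷ ys} x∈ = ∈-cartesianProductWith⁺ Vec._∷_
      (∈-filter⁺ head? (∈-allFin y)
        (subst (λ z → z ≅ c zero [mod q ]) (first-row y ys) (solution zero)))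
      (∈-filter⁺ tail? (∈-points ys)
        (λ i → subst (λ z → z ≅ c (suc i) [mod q ]) (other-row i y ys) (solution (suc i))))
      where
      solution : Solves (diag (d ∷ ds)) c q (y Vec.∷ ys)
      solution = proj₂ (∈-filter⁻ (solves? (diag (d ∷ ds)) c q) {xs = points q (suc n)} x∈)

    solve-∷ : ∀ y ys → + d ℤ.* + toℕ y ≅ c zero [mod q ] → Solves (diag ds) (c ∘ suc) q ys →
              Solves (diag (d ∷ ds)) c q (y Vec.∷ ys)
    solve-∷ y ys head tail zero    = subst (λ z → z ≅ c zero [mod q ]) (sym (first-row y ys)) head
    solve-∷ y ys head tail (suc i) =
      subst (λ z → z ≅ c (suc i) [mod q ]) (sym (other-row i y ys)) (tail i)

    from : ∀ {x} → x ∈ cartesianProductWith Vec._∷_ heads tails → x ∈ solutions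
    from x∈ = split (∈-cartesianProductWith⁻ Vec._∷_ heads tails x∈)
      where
      split : ∀ {x} → (∃₂ λ y ys → y ∈ heads × ys ∈ tails × x ≡ y Vec.∷ ys) → x ∈ solutions
      split (y , ys , y∈ , ys∈ , refl) =
        ∈-filter⁺ (solves? (diag (d ∷ ds)) c q) (∈-points (y Vec.∷ ys))
          (solve-∷ y ys (proj₂ (∈-filter⁻ head? {xs = allFin q} y∈))
                        (proj₂ (∈-filter⁻ tail? {xs = points q n} ys∈)))

-- A matrix and its augmentation by a column

sum-++ : {n : ℕ} (f : Vector ℤ (n ℕ.+ 1)) →
         ℤΣ.sum f ≡ ℤΣ.sum (λ j → f (j ↑ˡ 1)) ℤ.+ f (n ↑ʳ zero)
sum-++ {zero}  f = ℤ.+-comm (f zero) 0ℤ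
sum-++ {suc n} f = trans (cong (ℤ._+_ (f zero)) (sum-++ (f ∘ suc)))
  (sym (ℤ.+-assoc (f zero) (ℤΣ.sum (λ j → f (suc j ↑ˡ 1))) (f (suc (n ↑ʳ zero)))))

module _ {m n : ℕ} {C : Matrix ℤ m n} {c : Vector ℤ m}
         (S : SmithForm C) (S̄ : SmithForm (augment C c)) where
  open SmithForm S
  open SmithForm S̄ using () renaming (factors to factors̄)

  factors-augment-∣ : ∀ j → nth factors̄ (suc j) ℕ∣.∣ nth factors (suc j)
  factors-augment-∣ j = interlace S S̄ R
    (λ i k → divides-difference (≈-reflexive (sym (restrict i k)))) ℕ∣.∣-refl
    where
    -- The transpose of [I 0]: multiplying by it on the right deletes the last column.
    R : Matrix ℤ (n ℕ.+ 1) n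
    R a k = augment Id (λ _ → 0ℤ) k a
    restrict : ∀ i k → (augment C c · R) i k ≡ C i k
    restrict i k = begin
      (augment C c · R) i k
        ≡⟨ sum-++ {n} (λ a → augment C c i a ℤ.* R a k) ⟩
      ℤΣ.sum (λ a → augment C c i (a ↑ˡ 1) ℤ.* R (a ↑ˡ 1) k)
        ℤ.+ augment C c i (n ↑ʳ zero) ℤ.* R (n ↑ʳ zero) k
        ≡⟨ cong₂ ℤ._+_
             (ℤΣ.sum-cong-≗ λ a → trans (cong₂ ℤ._*_ (augment-left C c i a) (augment-left Id _ k a))
                                        (ℤ.*-comm (C i a) (Id k a)))
             (trans (cong (augment C c i (n ↑ʳ zero) ℤ.*_) (augment-right Id (λ _ → 0ℤ) k))
                    (ℤ.*-zeroʳ (augment C c i (n ↑ʳ zero)))) ⟩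
      ℤΣ.sum (λ a → Id k a ℤ.* C i a) ℤ.+ 0ℤ
        ≡⟨ ℤ.+-identityʳ _ ⟩
      ℤΣ.sum (λ a → Id k a ℤ.* C i a)
        ≡⟨ Id-select k (C i) ⟩
      C i k ∎

  -- A solution x makes the last column of [C c] redundant: [C c] ≡ C [I x] modulo q.
  solution⇒∣ : ∀ {q} {x : Point q n} → Solves C c q x →
               ∀ j → gcd q (nth factors (suc j)) ℕ∣.∣ nth factors̄ (suc j)
  solution⇒∣ {q} {x} sol j = interlace S̄ S (augment Id (values x))
    (λ i k → divides-difference (≈-weaken (gcd[m,n]∣m q (nth factors (suc j)))
      (subst (λ k → Congruent q (augment C c i k) ((C · augment Id (values x)) i k))
        (Fin.join-splitAt n 1 k) (col i (Fin.splitAt n k)))))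
    (gcd[m,n]∣n q (nth factors (suc j)))
    where
    col : ∀ i k → Congruent q (augment C c i (Fin.join n 1 k))
                              ((C · augment Id (values x)) i (Fin.join n 1 k))
    col i (inj₁ k) = ≈-reflexive (trans (augment-left C c i k) (trans (sym (·-identityʳ C i k))
      (ℤΣ.sum-cong-≗ λ a → cong (C i a ℤ.*_) (sym (augment-left Id (values x) a k)))))
    col i (inj₂ zero) = ≈-trans (≈-reflexive (augment-right C c i)) (≈-trans (≈-sym (congruent (sol i)))
      (≈-reflexive (ℤΣ.sum-cong-≗ λ a → cong (C i a ℤ.*_) (sym (augment-right Id (values x) a)))))

  #solutions-formula : ∀ q .{{_ : ℕ.NonZero q}} →
                       (∀ j → gcd q (nth factors (suc j)) ℕ∣.∣ nth factors̄ (suc j)) →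
                       #solutions C c q ≡
                       product (map (λ j → gcd (nth factors j) q) (range (length factors)))
                         ℕ.* q ℕ.^ (n ℕ.∸ length factors)
  #solutions-formula q g∣ = trans (#solutions-diagonal S c) (trans
    (#solutions-diag factors length≤rows length≤cols (P ⊙ c) (gcds-divide S c S̄ q g∣))
    (cong (λ ds → product ds ℕ.* q ℕ.^ (n ℕ.∸ length factors))
      (sym (map-range (λ d → gcd d q) factors))))

-- List sums and inclusion–exclusion

∑-cong∈ : {X : Set} (xs : List X) {f g : X → ℤ} → (∀ {x} → x ∈ xs → f x ≡ g x) →
          (∑[ xs ] f) ≡ (∑[ xs ] g)
∑-cong∈ []       h = refl
∑-cong∈ (x ∷ xs) h = cong₂ ℤ._+_ (h (here refl)) (∑-cong∈ xs (h ∘ there))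

∑-cong : {X : Set} (xs : List X) {f g : X → ℤ} → (∀ x → f x ≡ g x) → (∑[ xs ] f) ≡ (∑[ xs ] g)
∑-cong xs h = ∑-cong∈ xs λ {x} _ → h x

∑-zero : {X : Set} (xs : List X) → (∑[ xs ] λ _ → 0ℤ) ≡ 0ℤ
∑-zero []       = refl
∑-zero (x ∷ xs) = trans (ℤ.+-identityˡ _) (∑-zero xs)

∑-+ : {X : Set} (xs : List X) (f g : X → ℤ) →
      (∑[ xs ] λ x → f x ℤ.+ g x) ≡ (∑[ xs ] f) ℤ.+ (∑[ xs ] g)
∑-+ []       f g = refl
∑-+ (x ∷ xs) f g = trans (cong (ℤ._+_ (f x ℤ.+ g x)) (∑-+ xs f g))
  (solve 4 (λ a b c d → (a :+ b) :+ (c :+ d) := (a :+ c) :+ (b :+ d)) refl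
    (f x) (g x) (∑[ xs ] f) (∑[ xs ] g))

∑-* : {X : Set} (k : ℤ) (xs : List X) (f : X → ℤ) → (∑[ xs ] λ x → k ℤ.* f x) ≡ k ℤ.* (∑[ xs ] f)
∑-* k []       f = sym (ℤ.*-zeroʳ k)
∑-* k (x ∷ xs) f = trans (cong (ℤ._+_ (k ℤ.* f x)) (∑-* k xs f))
                         (sym (ℤ.*-distribˡ-+ k (f x) (∑[ xs ] f)))

∑-++ : {X : Set} (xs ys : List X) (f : X → ℤ) → (∑[ xs ++ ys ] f) ≡ (∑[ xs ] f) ℤ.+ (∑[ ys ] f)
∑-++ []       ys f = sym (ℤ.+-identityˡ _)
∑-++ (x ∷ xs) ys f = trans (cong (ℤ._+_ (f x)) (∑-++ xs ys f))
                           (sym (ℤ.+-assoc (f x) (∑[ xs ] f) (∑[ ys ] f)))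

∑-map : {X Y : Set} (g : Y → X) (ys : List Y) (f : X → ℤ) → (∑[ map g ys ] f) ≡ (∑[ ys ] (f ∘ g))
∑-map g []       f = refl
∑-map g (y ∷ ys) f = cong (ℤ._+_ (f (g y))) (∑-map g ys f)

∑-comm : {X Y : Set} (xs : List X) (ys : List Y) (f : X → Y → ℤ) →
         (∑[ xs ] λ x → ∑[ ys ] f x) ≡ (∑[ ys ] λ y → ∑[ xs ] λ x → f x y)
∑-comm []       ys f = sym (∑-zero ys)
∑-comm (x ∷ xs) ys f = trans (cong (ℤ._+_ (∑[ ys ] f x)) (∑-comm xs ys f))
                             (sym (∑-+ ys (f x) (λ y → ∑[ xs ] λ x → f x y)))

∑-filter : {X : Set} {P : X → Set} (P? : Decidable P) (xs : List X) (f : X → ℤ) →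
           (∀ x → ¬ P x → f x ≡ 0ℤ) → (∑[ xs ] f) ≡ (∑[ filter P? xs ] f)
∑-filter P? []       f h = refl
∑-filter P? (x ∷ xs) f h with P? x
... | yes _ = cong (ℤ._+_ (f x)) (∑-filter P? xs f h)
... | no ¬p = trans (cong₂ ℤ._+_ (h x ¬p) (∑-filter P? xs f h)) (ℤ.+-identityˡ _)

⟦_⟧ : {P : Set} → Dec P → ℤ
⟦ p? ⟧ = if does p? then 1ℤ else 0ℤ

module _ {P : Set} where

  ⟦⟧-cong : {Q : Set} → P ⇔ Q → (p? : Dec P) (q? : Dec Q) → ⟦ p? ⟧ ≡ ⟦ q? ⟧
  ⟦⟧-cong P⇔Q p? q? = cong (λ b → if b then 1ℤ else 0ℤ) (does-⇔ P⇔Q p? q?)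

  ⟦⟧-false : ¬ P → (p? : Dec P) → ⟦ p? ⟧ ≡ 0ℤ
  ⟦⟧-false ¬p p? = cong (λ b → if b then 1ℤ else 0ℤ) (dec-false p? ¬p)

length-filter-∑ : {X : Set} {P : X → Set} (P? : Decidable P) (xs : List X) →
                  + length (filter P? xs) ≡ ∑[ xs ] λ x → ⟦ P? x ⟧
length-filter-∑ P? []       = refl
length-filter-∑ P? (x ∷ xs) with P? x
... | yes _ = cong (ℤ._+_ 1ℤ) (length-filter-∑ P? xs)
... | no  _ = trans (length-filter-∑ P? xs) (sym (ℤ.+-identityˡ _))

sign : {m : ℕ} → Subset m → ℤ
sign J = -1ℤ ℤ.^ ∣ J ∣

-- Induction on m, pairing each subset with and without the first index. If P holds there, the two
-- indicators agree and the signs cancel; if not, the subsets containing that index contribute zero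
-- and the others form the sum for m.
inclusion-exclusion : {m : ℕ} {P : Fin m → Set} (P? : Decidable P) →
  ⟦ ¬? (Fin.any? P?) ⟧ ≡ ∑[ subsets m ] λ J → sign J ℤ.* ⟦ Fin.all? (P? ∘ element J) ⟧
inclusion-exclusion {zero}  P? = refl
inclusion-exclusion {suc m} {P} P? = sym (begin
  (∑[ map (inside Vec.∷_) (subsets m) ++ map (outside Vec.∷_) (subsets m) ++ [] ] f)
    ≡⟨ ∑-++ (map (inside Vec.∷_) (subsets m)) _ f ⟩
  (∑[ map (inside Vec.∷_) (subsets m) ] f) ℤ.+ (∑[ map (outside Vec.∷_) (subsets m) ++ [] ] f)
    ≡⟨ cong₂ ℤ._+_ (∑-map (inside Vec.∷_) (subsets m) f)
         (trans (cong (λ Js → ∑[ Js ] f) (List.++-identityʳ (map (outside Vec.∷_) (subsets m))))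
           (∑-map (outside Vec.∷_) (subsets m) f)) ⟩
  (∑[ subsets m ] (f ∘ (inside Vec.∷_))) ℤ.+ (∑[ subsets m ] g)
    ≡⟨ by-head (P? zero) ⟩
  ⟦ ¬? (Fin.any? P?) ⟧ ∎)
  where
  f : Subset (suc m) → ℤ
  f J = sign J ℤ.* ⟦ Fin.all? (P? ∘ element J) ⟧
  g : Subset m → ℤ
  g J = sign J ℤ.* ⟦ Fin.all? (P? ∘ suc ∘ element J) ⟧
  by-head : Dec (P zero) →
            (∑[ subsets m ] (f ∘ (inside Vec.∷_))) ℤ.+ (∑[ subsets m ] g) ≡ ⟦ ¬? (Fin.any? P?) ⟧
  by-head (yes p) = begin
    (∑[ subsets m ] (f ∘ (inside Vec.∷_))) ℤ.+ (∑[ subsets m ] g)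
      ≡⟨ ∑-+ (subsets m) (f ∘ (inside Vec.∷_)) g ⟨
    (∑[ subsets m ] λ J → f (inside Vec.∷ J) ℤ.+ g J)
      ≡⟨ ∑-cong (subsets m) cancel ⟩
    (∑[ subsets m ] λ _ → 0ℤ)
      ≡⟨ ∑-zero (subsets m) ⟩
    0ℤ
      ≡⟨ ⟦⟧-false (λ none → none (zero , p)) (¬? (Fin.any? P?)) ⟨
    ⟦ ¬? (Fin.any? P?) ⟧ ∎
    where
    cancel : ∀ J → f (inside Vec.∷ J) ℤ.+ g J ≡ 0ℤ
    cancel J = trans
      (cong (λ t → -1ℤ ℤ.* sign J ℤ.* t ℤ.+ g J)
        (⟦⟧-cong (mk⇔ (λ all i → all (suc i)) (λ where all zero → p ; all (suc i) → all i))
          (Fin.all? (P? ∘ element (inside Vec.∷ J))) (Fin.all? (P? ∘ suc ∘ element J))))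
      (solve 2 (λ s t → con -1ℤ :* s :* t :+ s :* t := con 0ℤ) refl
        (sign J) ⟦ Fin.all? (P? ∘ suc ∘ element J) ⟧)
  by-head (no ¬p) = begin
    (∑[ subsets m ] (f ∘ (inside Vec.∷_))) ℤ.+ (∑[ subsets m ] g)
      ≡⟨ cong (ℤ._+ (∑[ subsets m ] g)) (trans (∑-cong (subsets m) vanish) (∑-zero (subsets m))) ⟩
    0ℤ ℤ.+ (∑[ subsets m ] g)
      ≡⟨ ℤ.+-identityˡ (∑[ subsets m ] g) ⟩
    (∑[ subsets m ] g)
      ≡⟨ inclusion-exclusion (P? ∘ suc) ⟨
    ⟦ ¬? (Fin.any? (P? ∘ suc)) ⟧
      ≡⟨ ⟦⟧-cong (mk⇔ (λ where none (zero , p) → ¬p p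
                               none (suc i , p) → none (i , p))
                      (λ none (i , p) → none (suc i , p)))
           (¬? (Fin.any? (P? ∘ suc))) (¬? (Fin.any? P?)) ⟩
    ⟦ ¬? (Fin.any? P?) ⟧ ∎
    where
    vanish : ∀ J → f (inside Vec.∷ J) ≡ 0ℤ
    vanish J = trans (cong (sign (inside Vec.∷ J) ℤ.*_)
        (⟦⟧-false (λ all → ¬p (all zero)) (Fin.all? (P? ∘ element (inside Vec.∷ J)))))
      (ℤ.*-zeroʳ (sign (inside Vec.∷ J)))

∈-subsets : {m : ℕ} (J : Subset m) → J ∈ subsets m
∈-subsets Vec.[]            = here refl
∈-subsets (inside  Vec.∷ J) =
  ∈-cartesianProductWith⁺ Vec._∷_ {xs = inside ∷ outside ∷ []} (here refl) (∈-subsets J)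
∈-subsets (outside Vec.∷ J) =
  ∈-cartesianProductWith⁺ Vec._∷_ {xs = inside ∷ outside ∷ []} (there (here refl)) (∈-subsets J)

-- Polynomials

infixl 6 _⊞_
_⊞_ : Polynomial → Polynomial → Polynomial
[]       ⊞ p        = p
(c ∷ cs) ⊞ []       = c ∷ cs
(c ∷ cs) ⊞ (d ∷ ds) = c ℚ.+ d ∷ cs ⊞ ds

monomial : ℚ → ℕ → Polynomial
monomial c zero    = c ∷ []
monomial c (suc k) = 0ℚ ∷ monomial c k

eval-⊞ : ∀ p r t → eval (p ⊞ r) t ≡ eval p t ℚ.+ eval r t
eval-⊞ []       r        t = sym (ℚ.+-identityˡ (eval r t))
eval-⊞ (c ∷ cs) []       t = sym (ℚ.+-identityʳ (eval (c ∷ cs) t))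
eval-⊞ (c ∷ cs) (d ∷ ds) t = trans (cong (λ z → c ℚ.+ d ℚ.+ t ℚ.* z) (eval-⊞ cs ds t))
  (S.solve 5 (λ c d t x y → (c S.:+ d) S.:+ t S.:* (x S.:+ y) S.:= (c S.:+ t S.:* x) S.:+ (d S.:+ t S.:* y))
    refl c d t (eval cs t) (eval ds t))
  where module S = ℚSolver.+-*-Solver

eval-monomial : ∀ c k q → eval (monomial (ι c) k) (ι (+ q)) ≡ ι (c ℤ.* + (q ℕ.^ k))
eval-monomial c zero    q = begin
  ι c ℚ.+ ι (+ q) ℚ.* 0ℚ   ≡⟨ cong (ι c ℚ.+_) (ℚ.*-zeroʳ (ι (+ q))) ⟩
  ι c ℚ.+ 0ℚ               ≡⟨ ℚ.+-identityʳ (ι c) ⟩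
  ι c                      ≡⟨ cong ι (ℤ.*-identityʳ c) ⟨
  ι (c ℤ.* 1ℤ)             ∎
eval-monomial c (suc k) q = begin
  0ℚ ℚ.+ ι (+ q) ℚ.* eval (monomial (ι c) k) (ι (+ q))   ≡⟨ ℚ.+-identityˡ _ ⟩
  ι (+ q) ℚ.* eval (monomial (ι c) k) (ι (+ q))          ≡⟨ cong (ι (+ q) ℚ.*_) (eval-monomial c k q) ⟩
  ι (+ q) ℚ.* ι (c ℤ.* + (q ℕ.^ k))                      ≡⟨ ι-* (+ q) (c ℤ.* + (q ℕ.^ k)) ⟨
  ι (+ q ℤ.* (c ℤ.* + (q ℕ.^ k)))                        ≡⟨ cong ι (solve 3 (λ q c x → q :* (c :* x) := c :* (q :* x)) refl
                                                              (+ q) c (+ (q ℕ.^ k))) ⟩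
  ι (c ℤ.* (+ q ℤ.* + (q ℕ.^ k)))                        ≡⟨ cong (λ z → ι (c ℤ.* z)) (ℤ.pos-* q (q ℕ.^ k)) ⟨
  ι (c ℤ.* + (q ℕ.^ suc k))                              ∎

module _ {X : Set} (c : X → ℤ) (k : X → ℕ) where

  polynomial : List X → Polynomial
  polynomial []       = []
  polynomial (x ∷ xs) = monomial (ι (c x)) (k x) ⊞ polynomial xs

  eval-polynomial : ∀ xs q → eval (polynomial xs) (ι (+ q)) ≡ ι (∑[ xs ] λ x → c x ℤ.* + (q ℕ.^ k x))
  eval-polynomial []       q = refl
  eval-polynomial (x ∷ xs) q = begin
    eval (monomial (ι (c x)) (k x) ⊞ polynomial xs) (ι (+ q))
      ≡⟨ eval-⊞ (monomial (ι (c x)) (k x)) (polynomial xs) (ι (+ q)) ⟩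
    eval (monomial (ι (c x)) (k x)) (ι (+ q)) ℚ.+ eval (polynomial xs) (ι (+ q))
      ≡⟨ cong₂ ℚ._+_ (eval-monomial (c x) (k x) q) (eval-polynomial xs q) ⟩
    ι (c x ℤ.* + (q ℕ.^ k x)) ℚ.+ ι (∑[ xs ] λ x → c x ℤ.* + (q ℕ.^ k x))
      ≡⟨ ι-+ (c x ℤ.* + (q ℕ.^ k x)) _ ⟨
    ι (∑[ x ∷ xs ] λ x → c x ℤ.* + (q ℕ.^ k x)) ∎

-- Maxima, common multiples and periodicity of gcds

≤-max : {X : Set} (f : X → ℕ) {xs : List X} {x : X} → x ∈ xs → f x ≤ foldr ℕ._⊔_ 0 (map f xs)
≤-max f {x ∷ xs} (here refl) = ℕ.m≤m⊔n (f x) _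
≤-max f {y ∷ xs} (there x∈)  = ℕ.≤-trans (≤-max f x∈) (ℕ.m≤n⊔m (f y) _)

∣-lcm : {X : Set} (f : X → ℕ) {xs : List X} {x : X} → x ∈ xs → f x ℕ∣.∣ foldr lcm 1 (map f xs)
∣-lcm f {x ∷ xs} (here refl) = m∣lcm[m,n] (f x) _
∣-lcm f {y ∷ xs} (there x∈)  = ℕ∣.∣-trans (∣-lcm f x∈) (n∣lcm[m,n] (f y) _)

-- An lcm divides the product of its arguments, and zero divides no positive product.
lcm-positive : {X : Set} (f : X → ℕ) (xs : List X) → (∀ x → 0 < f x) → 0 < foldr lcm 1 (map f xs)
lcm-positive f []       h = s≤s z≤n
lcm-positive f (x ∷ xs) h = ℕ.n≢0⇒n>0 λ lcm≡0 → ℕ.>⇒≢ product>0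
  (ℕ∣.0∣⇒≡0 (subst (ℕ∣._∣ f x ℕ.* L) lcm≡0 (lcm-least (ℕ∣.m∣m*n {f x} L) (ℕ∣.n∣m*n (f x) {L}))))
  where
  L = foldr lcm 1 (map f xs)
  product>0 : 0 < f x ℕ.* L
  product>0 = ℕ.*-mono-≤ (h x) (lcm-positive f xs h)

All-range⁺ : {P : ℕ → Set} (k : ℕ) → (∀ {j} → j < k → P (suc j)) → All P (range k)
All-range⁺ k h = All.map⁺ (All.applyUpTo⁺₁ (λ j → j) k h)

All-range⁻ : {P : ℕ → Set} (k : ℕ) → All P (range k) → ∀ {j} → j < k → P (suc j)
All-range⁻ k h = All.applyUpTo⁻ (λ j → j) k (All.map⁻ h)

gcd-periodic : ∀ {ρ e q q′} → e ℕ∣.∣ ρ → Congruent ρ (+ q) (+ q′) → gcd q e ≡ gcd q′ e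
gcd-periodic {ρ} {e} {q} {q′} e∣ρ q≈q′ = ℕ∣.∣-antisym (half q≈q′) (half (≈-sym q≈q′))
  where
  half : ∀ {q q′} → Congruent ρ (+ q) (+ q′) → gcd q e ℕ∣.∣ gcd q′ e
  half {q} {q′} q≈q′ = gcd-greatest
    (∣⇒∣ᵤ {i = + q′} (∣-transfer {x = + q′} {+ q}
      (divides-difference (≈-sym (≈-weaken (ℕ∣.∣-trans (gcd[m,n]∣n q e) e∣ρ) q≈q′)))
      (∣ᵤ⇒∣ (gcd[m,n]∣m q e))))
    (gcd[m,n]∣n q e)

-- The arrangement

module _ {m n l : ℕ} (A : Matrix ℤ m n) (a : Vector ℤ m) (B : Matrix ℤ l n) (b : Vector ℤ l) where
  open Arrangement A a B b

  private
    #solutionsᴶ : Subset m → ℕ → ℕ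
    #solutionsᴶ J = #solutions (C J) (c J)

    gcds-agree? : ∀ J q → Dec (All (λ j → gcd q (d J j) ≡ gcd q (d̄ J j)) (range (r̄ J)))
    gcds-agree? J q = All.all? (λ j → gcd q (d J j) ℕ.≟ gcd q (d̄ J j)) (range (r̄ J))

    d̄∣d : ∀ J j → d̄ J (suc j) ℕ∣.∣ d J (suc j)
    d̄∣d J = factors-augment-∣ {c = c J} (smith (C J)) (smith (C̄ J))

    d-beyond : ∀ J {j} → r J ≤ j → d J (suc j) ≡ 0
    d-beyond J r≤j = nth-beyond (invariantFactors (C J)) (subst (_≤ _) (rank≡length (C J)) r≤j)

    d̄-beyond : ∀ J {j} → r̄ J ≤ j → d̄ J (suc j) ≡ 0
    d̄-beyond J r̄≤j = nth-beyond (invariantFactors (C̄ J)) (subst (_≤ _) (rank≡length (C̄ J)) r̄≤j)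

  -- Agreement of the gcds up to r̄ is solvability. It gives gcd(q, dⱼ) ∣ d̄ⱼ for every j, as d̄ⱼ is
  -- zero beyond r̄, and then the solutions are counted. Conversely a solution gives these
  -- divisibilities, and d̄ⱼ ∣ dⱼ upgrades them to equalities; so disagreement means no solutions,
  -- which is the value 0 in `d̃`.
  #solutions-d̃ : ∀ J q → 0 < q → #solutionsᴶ J q ≡ d̃ J q ℕ.* q ℕ.^ (n ℕ.∸ r J)
  #solutions-d̃ J q 0<q = by-gcds (gcds-agree? J q)
    where
    instance
      q-nonZero : ℕ.NonZero q
      q-nonZero = ℕ.>-nonZero 0<q
    by-gcds : (agree? : Dec (All (λ j → gcd q (d J j) ≡ gcd q (d̄ J j)) (range (r̄ J)))) →
              #solutionsᴶ J q ≡ (if does agree? then dProd J q else 0) ℕ.* q ℕ.^ (n ℕ.∸ r J)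
    by-gcds (yes agree) = trans
      (#solutions-formula {C = C J} {c = c J} (smith (C J)) (smith (C̄ J)) q gcd∣d̄)
      (cong (λ k → product (map (λ j → gcd (d J j) q) (range k)) ℕ.* q ℕ.^ (n ℕ.∸ k))
        (sym (rank≡length (C J))))
      where
      gcd∣d̄ : ∀ j → gcd q (d J (suc j)) ℕ∣.∣ d̄ J (suc j)
      gcd∣d̄ j with j ℕ.<? r̄ J
      ... | yes j<r̄ = subst (ℕ∣._∣ d̄ J (suc j)) (sym (All-range⁻ (r̄ J) agree j<r̄))
                        (gcd[m,n]∣n q (d̄ J (suc j)))
      ... | no  j≮r̄ = subst (gcd q (d J (suc j)) ℕ∣.∣_) (sym (d̄-beyond J (ℕ.≮⇒≥ j≮r̄))) (_ ℕ∣.∣0)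
    by-gcds (no disagree) = cong length
      (List.filter-none (solves? (C J) (c J) q) {xs = points q n} (All.universal unsolvable (points q n)))
      where
      unsolvable : ∀ x → ¬ Solves (C J) (c J) q x
      unsolvable x sol = disagree (All-range⁺ (r̄ J) λ {j} _ → ℕ∣.∣-antisym
        (gcd-greatest (gcd[m,n]∣m q (d J (suc j)))
          (solution⇒∣ {C = C J} {c = c J} (smith (C J)) (smith (C̄ J)) {x = x} sol j))
        (gcd-greatest (gcd[m,n]∣m q (d̄ J (suc j)))
          (ℕ∣.∣-trans (gcd[m,n]∣n q (d̄ J (suc j))) (d̄∣d J j))))

  module _ (q : ℕ) (x : Point q n) where
    private
      OnHyperplane : Fin m → Set
      OnHyperplane i = A i • x ≅ a i [mod q ]

      onHyperplane? : Decidable OnHyperplane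
      onHyperplane? i = (A i • x) ≅? a i [mod q ]

    solves-C⇒ : ∀ {J} → Solves (C J) (c J) q x → InV q x × (∀ i → OnHyperplane (element J i))
    solves-C⇒ {J} sol =
      (λ k → subst₂ (λ α t → α • x ≅ t [mod q ])
        (Vector.lookup-++ˡ B (A ∘ element J) k) (Vector.lookup-++ˡ b (a ∘ element J) k)
        (sol (k ↑ˡ ∣ J ∣))) ,
      (λ i → subst₂ (λ α t → α • x ≅ t [mod q ])
        (Vector.lookup-++ʳ B (A ∘ element J) i) (Vector.lookup-++ʳ b (a ∘ element J) i)
        (sol (l ↑ʳ i)))

    solves-C⇐ : ∀ {J} → InV q x → (∀ i → OnHyperplane (element J i)) → Solves (C J) (c J) q x
    solves-C⇐ {J} inV on k = subst (λ k → C J k • x ≅ c J k [mod q ]) (Fin.join-splitAt l ∣ J ∣ k)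
      (rows (Fin.splitAt l k))
      where
      rows : ∀ k → C J (Fin.join l ∣ J ∣ k) • x ≅ c J (Fin.join l ∣ J ∣ k) [mod q ]
      rows (inj₁ k) = subst₂ (λ α t → α • x ≅ t [mod q ])
        (sym (Vector.lookup-++ˡ B (A ∘ element J) k)) (sym (Vector.lookup-++ˡ b (a ∘ element J) k)) (inV k)
      rows (inj₂ i) = subst₂ (λ α t → α • x ≅ t [mod q ])
        (sym (Vector.lookup-++ʳ B (A ∘ element J) i)) (sym (Vector.lookup-++ʳ b (a ∘ element J) i)) (on i)

    -- On V this is inclusion-exclusion over the hyperplanes through x. Off V both sides vanish,
    -- since every system `C J` contains the equations of B.
    inM-∑ : ⟦ inM? q x ⟧ ≡ ∑[ subsets m ] λ J → sign J ℤ.* ⟦ solves? (C J) (c J) q x ⟧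
    inM-∑ = by-V (inV? q x)
      where
      by-V : Dec (InV q x) →
             ⟦ inM? q x ⟧ ≡ ∑[ subsets m ] λ J → sign J ℤ.* ⟦ solves? (C J) (c J) q x ⟧
      by-V (yes inV) = begin
        ⟦ inM? q x ⟧
          ≡⟨ ⟦⟧-cong (mk⇔ (λ (_ , none) (i , on) → none (i , inV , on))
                          (λ none → inV , λ (i , _ , on) → none (i , on)))
               (inM? q x) (¬? (Fin.any? onHyperplane?)) ⟩
        ⟦ ¬? (Fin.any? onHyperplane?) ⟧
          ≡⟨ inclusion-exclusion onHyperplane? ⟩
        (∑[ subsets m ] λ J → sign J ℤ.* ⟦ Fin.all? (onHyperplane? ∘ element J) ⟧)
          ≡⟨ ∑-cong (subsets m) (λ J → cong (sign J ℤ.*_)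
               (⟦⟧-cong (mk⇔ (solves-C⇐ {J} inV) (proj₂ ∘ solves-C⇒ {J}))
                 (Fin.all? (onHyperplane? ∘ element J)) (solves? (C J) (c J) q x))) ⟩
        (∑[ subsets m ] λ J → sign J ℤ.* ⟦ solves? (C J) (c J) q x ⟧) ∎
      by-V (no ¬inV) = begin
        ⟦ inM? q x ⟧
          ≡⟨ ⟦⟧-false (¬inV ∘ proj₁) (inM? q x) ⟩
        0ℤ
          ≡⟨ ∑-zero (subsets m) ⟨
        (∑[ subsets m ] λ _ → 0ℤ)
          ≡⟨ ∑-cong (subsets m) (λ J → trans (cong (sign J ℤ.*_)
               (⟦⟧-false (¬inV ∘ proj₁ ∘ solves-C⇒ {J}) (solves? (C J) (c J) q x))) (ℤ.*-zeroʳ (sign J))) ⟨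
        (∑[ subsets m ] λ J → sign J ℤ.* ⟦ solves? (C J) (c J) q x ⟧) ∎

  #M-∑ : ∀ q → 0 < q → + #M q ≡ ∑[ subsets m ] term q
  #M-∑ q 0<q = begin
    + #M q
      ≡⟨ length-filter-∑ (inM? q) (points q n) ⟩
    (∑[ points q n ] λ x → ⟦ inM? q x ⟧)
      ≡⟨ ∑-cong (points q n) (inM-∑ q) ⟩
    (∑[ points q n ] λ x → ∑[ subsets m ] λ J → sign J ℤ.* ⟦ solves? (C J) (c J) q x ⟧)
      ≡⟨ ∑-comm (points q n) (subsets m) (λ x J → sign J ℤ.* ⟦ solves? (C J) (c J) q x ⟧) ⟩
    (∑[ subsets m ] λ J → ∑[ points q n ] λ x → sign J ℤ.* ⟦ solves? (C J) (c J) q x ⟧)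
      ≡⟨ ∑-cong (subsets m) (λ J → begin
           (∑[ points q n ] λ x → sign J ℤ.* ⟦ solves? (C J) (c J) q x ⟧)
             ≡⟨ ∑-* (sign J) (points q n) (λ x → ⟦ solves? (C J) (c J) q x ⟧) ⟩
           sign J ℤ.* (∑[ points q n ] λ x → ⟦ solves? (C J) (c J) q x ⟧)
             ≡⟨ cong (sign J ℤ.*_) (length-filter-∑ (solves? (C J) (c J) q) (points q n)) ⟨
           sign J ℤ.* + #solutionsᴶ J q
             ≡⟨ cong (λ k → sign J ℤ.* + k) (#solutions-d̃ J q 0<q) ⟩
           term q J ∎) ⟩
    ∑[ subsets m ] term q ∎

  term-vanishes : ∀ q → q₀ < q → ∀ J → r̄ J ≢ r J → term q J ≡ 0ℤ
  term-vanishes q q₀<q J r̄≢r = trans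
    (cong (λ b → sign J ℤ.* + ((if b then dProd J q else 0) ℕ.* q ℕ.^ (n ℕ.∸ r J)))
      (dec-false (gcds-agree? J q) disagree))
    (ℤ.*-zeroʳ (sign J))
    where
    r̄≡1+r : r̄ J ≡ suc (r J)
    r̄≡1+r = ℕ.≤-antisym (rank-augment≤1+rank (C J) (c J))
      (ℕ.≤∧≢⇒< (rank≤rank-augment (C J) (c J)) (r̄≢r ∘ sym))
    J∈ : J ∈ inconsistent
    J∈ = ∈-filter⁺ (λ J → r̄ J ℕ.≟ r J ℕ.+ 1) (∈-subsets J) (trans r̄≡1+r (ℕ.+-comm 1 (r J)))
    -- Zero would be divisible by every q. Because r̄ = r + 1, this index is that of the last
    -- genuine invariant factor of `C̄ J`.
    d̄>0 : 0 < d̄ J (suc (r J))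
    d̄>0 = nth-positive (SmithForm.positive (smith (C̄ J)))
      (ℕ.≤-reflexive (trans (sym r̄≡1+r) (rank≡length (C̄ J))))
    d̄<q : d̄ J (suc (r J)) < q
    d̄<q = ℕ.≤-<-trans (subst (λ k → d̄ J k ≤ q₀) r̄≡1+r (≤-max (λ J → d̄ J (r̄ J)) J∈)) q₀<q
    disagree : ¬ All (λ j → gcd q (d J j) ≡ gcd q (d̄ J j)) (range (r̄ J))
    disagree agree = ℕ∣.>⇒∤ {{ℕ.>-nonZero d̄>0}} d̄<q
      (subst (ℕ∣._∣ d̄ J (suc (r J)))
        (trans (sym (All-range⁻ (r̄ J) agree (ℕ.≤-reflexive (sym r̄≡1+r))))
          (trans (cong (gcd q) (d-beyond J ℕ.≤-refl)) (gcd-identityʳ q)))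
        (gcd[m,n]∣n q (d̄ J (suc (r J)))))

  -- Periodicity and the quasi-polynomial

  d-last-positive : ∀ J → 0 < d J (r J)
  d-last-positive J = positive (r J) (ℕ.≤-reflexive (rank≡length (C J)))
    where
    positive : ∀ k → k ≤ length (invariantFactors (C J)) → 0 < d J k
    -- At rank zero the value is the default 1 of `nth` at index 0.
    positive zero    _     = s≤s z≤n
    positive (suc k) k<len = nth-positive (SmithForm.positive (smith (C J))) k<len

  ρC-positive : 0 < ρC
  ρC-positive = lcm-positive (λ J → d J (r J)) consistent d-last-positive

  d∣ρC : ∀ {J} → J ∈ consistent → ∀ {j} → j < r J → d J (suc j) ℕ∣.∣ ρC
  d∣ρC {J} J∈ {j} j<r = ℕ∣.∣-trans (last (r J) j<r) (∣-lcm (λ J → d J (r J)) J∈)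
    where
    last : ∀ k → j < k → d J (suc j) ℕ∣.∣ d J k
    last (suc k) (s≤s j≤k) = nth-chain (SmithForm.chain (smith (C J))) j≤k

  -- Consistency keeps the condition within indices j ≤ r, so no zero dⱼ occurs. There dⱼ divides ρC
  -- through the last factor, and d̄ⱼ does so through dⱼ, hence every gcd involved depends only on
  -- the class of q modulo ρC.
  d̃-periodic : ∀ {J} → J ∈ consistent → ∀ {q q′} → Congruent ρC (+ q) (+ q′) → d̃ J q ≡ d̃ J q′
  d̃-periodic {J} J∈ {q} {q′} q≈q′ = cong₂ (λ b k → if b then k else 0)
    (does-⇔ (mk⇔ (transport q≈q′) (transport (≈-sym q≈q′))) (gcds-agree? J q) (gcds-agree? J q′))
    (cong product (List.map-cong-local (All-range⁺ (r J) λ {j} j<r →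
      trans (gcd-comm (d J (suc j)) q)
        (trans (gcd-periodic (d∣ρC J∈ j<r) q≈q′) (gcd-comm q′ (d J (suc j)))))))
    where
    r̄≡r : r̄ J ≡ r J
    r̄≡r = proj₂ (∈-filter⁻ (λ J → r̄ J ℕ.≟ r J) {xs = subsets m} J∈)
    transport : ∀ {q q′} → Congruent ρC (+ q) (+ q′) →
                All (λ j → gcd q (d J j) ≡ gcd q (d̄ J j)) (range (r̄ J)) →
                All (λ j → gcd q′ (d J j) ≡ gcd q′ (d̄ J j)) (range (r̄ J))
    transport q≈q′ agree = All-range⁺ (r̄ J) λ {j} j<r̄ → let j<r = subst (j <_) r̄≡r j<r̄ in
      trans (sym (gcd-periodic (d∣ρC J∈ j<r) q≈q′))
        (trans (All-range⁻ (r̄ J) agree j<r̄)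
          (gcd-periodic (ℕ∣.∣-trans (d̄∣d J j) (d∣ρC J∈ j<r)) q≈q′))

  χ : ℕ → ℚ
  χ q = (∑[ consistent ] term q) / 1

  χ-quasiPolynomial : IsQuasiPolynomial χ ρC
  χ-quasiPolynomial = record
    { period-positive = ρC-positive
    -- Residue classes are represented by 1, ..., ρC. As `d̃` is constant on a class, its values at
    -- the representative serve as coefficients.
    ; constituent     = λ j → polynomial (coefficient (suc (toℕ j))) exponent consistent
    ; agrees          = λ q 0<q j q≅j → trans
        (cong ι (∑-cong∈ consistent λ {J} J∈ → begin
          sign J ℤ.* + (d̃ J q ℕ.* q ℕ.^ exponent J)
            ≡⟨ cong (sign J ℤ.*_) (ℤ.pos-* (d̃ J q) (q ℕ.^ exponent J)) ⟩
          sign J ℤ.* (+ d̃ J q ℤ.* + (q ℕ.^ exponent J))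
            ≡⟨ ℤ.*-assoc (sign J) (+ d̃ J q) (+ (q ℕ.^ exponent J)) ⟨
          coefficient q J ℤ.* + (q ℕ.^ exponent J)
            ≡⟨ cong (λ k → sign J ℤ.* + k ℤ.* + (q ℕ.^ exponent J))
                 (d̃-periodic J∈ (congruent q≅j)) ⟩
          coefficient (suc (toℕ j)) J ℤ.* + (q ℕ.^ exponent J) ∎))
        (sym (eval-polynomial (coefficient (suc (toℕ j))) exponent consistent q))
    }
    where
    exponent : Subset m → ℕ
    exponent J = n ℕ.∸ r J
    coefficient : ℕ → Subset m → ℤ
    coefficient q J = sign J ℤ.* + d̃ J q

theorem2p4 : ∀ {m n l : ℕ} (A : Matrix ℤ m n) (a : Vector ℤ m) (B : Matrix ℤ l n) (b : Vector ℤ l) →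
    let open Arrangement A a B b in
    (∀ q → 0 < q → + #M q ≡ ∑[ subsets m ] term q)
    × Σ (ℕ → ℚ) λ χ →
    IsQuasiPolynomial χ ρC
    × (∀ q → q₀ < q → + #M q / 1 ≡ χ q)
    × (∀ q → 0 < q → χ q ≡ (∑[ consistent ] term q) / 1)
theorem2p4 {m} A a B b =
  #M-∑ A a B b , χ A a B b , χ-quasiPolynomial A a B b ,
  -- Above q₀ the terms of all J outside `consistent` vanish, so the full sum equals the restricted
  -- one.
  (λ q q₀<q → cong ι (trans (#M-∑ A a B b q (ℕ.≤-<-trans z≤n q₀<q))
    (∑-filter (λ J → r̄ J ℕ.≟ r J) (subsets m) (term q) (term-vanishes A a B b q q₀<q)))) ,
  λ _ _ → refl
  where open Arrangement A a B b
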